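{- Let $T=\{2143,2341,4231\}$. Then $$F_T(x)=\frac{1-6x+13x^2-11x^3+5x^4}{(1-x)^2(1-2x)(1-3x+x^2)}.$$
   Context: $S_n(T)$ denotes the set of permutations $\pi$ of $[n]=\{1,\dots,n\}$ (one-line notation) that avoid every pattern $\tau\in T$, i.e. no subsequence of $\pi$ is order-isomorphic to $\tau$. $F_T(x)=\sum_{n\ge 0}|S_n(T)|x^n$, a formal power series, with $|S_0(T)|=1$. -}

module Defs where

open import Algebra.Bundles using (RawRing)
import Algebra.Definitions.RawSemiring as RawSemiringDefs
open import Data.Fin.Base using (Fin; cast)
import Data.Fin.Properties as Fin
open import Data.Integer.Base as ℤ using (ℤ; 0ℤ; 1ℤ; +_)
import Data.Integer.Properties as ℤ
open import Data.List.Base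
  using (List; []; _∷_; length; lookup; filter; foldr; applyUpTo; cartesianProductWith)
open import Data.List.Relation.Binary.Sublist.Propositional using (_⊆_; []; _∷_; _∷ʳ_)
open import Data.List.Relation.Unary.All using (All; all?)
import Data.List.Relation.Unary.Unique.DecPropositional as UniqueDec
open import Data.Nat.Base using (ℕ; zero; suc; _∸_; _<_)
import Data.Nat.Properties as ℕ
open import Data.Product.Base using (Σ; ∃; _×_; _,_)
open import Data.Sum.Base using (inj₁; inj₂; [_,_])
open import Function.Base using (_∘_)
open import Function.Bundles using (_⇔_; mk⇔; module Equivalence)
open import Level using (0ℓ)
open import Relation.Binary.PropositionalEquality
  using (_≡_; _≗_; refl; cong; module ≡-Reasoning)
open import Relation.Nullary.Decidable
  using (Dec; yes; no; map′; ¬?; True; toWitness; _×-dec_; _→-dec_; _⊎-dec_)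
open import Relation.Nullary.Negation using (¬_)
open import Relation.Unary using (Pred; Decidable)

open UniqueDec ℕ._≟_ using (Unique; unique?)

------------------------------------------------------------------------
-- Permutations and patterns, in one-line notation

Word : Set
Word = List ℕ

words : ℕ → List ℕ → List Word
words zero    _  = [] ∷ []
words (suc k) as = cartesianProductWith _∷_ as (words k as)

[1‥_] : ℕ → List ℕ
[1‥ n ] = applyUpTo suc n

-- A word of length n over {1,…,n} is a permutation of {1,…,n} exactly
-- when its letters are distinct.
permutations : ℕ → List Word
permutations n = filter unique? (words n [1‥ n ])

OrderIsomorphic : Word → Word → Set
OrderIsomorphic σ τ = Σ (length σ ≡ length τ) λ eq → ∀ (i j : Fin (length σ)) →
  lookup σ i < lookup σ j ⇔ lookup τ (cast eq i) < lookup τ (cast eq j)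

-- σ ⊆ π says that σ is a (not necessarily contiguous) subsequence of π.
_Contains_ : Word → Word → Set
π Contains τ = ∃ λ σ → σ ⊆ π × OrderIsomorphic σ τ

_Avoids_ : Word → Word → Set
π Avoids τ = ¬ (π Contains τ)

orderIsomorphic? : ∀ σ τ → Dec (OrderIsomorphic σ τ)
orderIsomorphic? σ τ with length σ ℕ.≟ length τ
... | no  neq = no λ (eq , _) → neq eq
... | yes eq  = map′ (eq ,_) (λ (_ , iso) → iso)
  (Fin.all? λ i → Fin.all? λ j →
    (lookup σ i ℕ.<? lookup σ j) ⇔-dec
    (lookup τ (cast eq i) ℕ.<? lookup τ (cast eq j)))
  where
  _⇔-dec_ : ∀ {A B : Set} → Dec A → Dec B → Dec (A ⇔ B)
  a? ⇔-dec b? = map′ (λ (f , g) → mk⇔ f g) (λ e → Equivalence.to e , Equivalence.from e)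
    ((a? →-dec b?) ×-dec (b? →-dec a?))

anySubsequence? : {P : Pred Word 0ℓ} → Decidable P → ∀ π → Dec (∃ λ σ → σ ⊆ π × P σ)
anySubsequence? P? [] = map′ (λ p → [] , [] , p) (λ { (.[] , [] , p) → p }) (P? [])
anySubsequence? {P} P? (a ∷ π) = map′
  [ (λ (σ , s , p) → σ , a ∷ʳ s , p) , (λ (σ , s , p) → a ∷ σ , refl ∷ s , p) ]
  (λ { (σ , .a ∷ʳ s , p)      → inj₁ (σ , s , p)
     ; (.a ∷ σ , refl ∷ s , p) → inj₂ (σ , s , p) })
  (anySubsequence? P? π ⊎-dec anySubsequence? (P? ∘ (a ∷_)) π)

_avoids?_ : ∀ π τ → Dec (π Avoids τ)
π avoids? τ = ¬? (anySubsequence? (λ σ → orderIsomorphic? σ τ) π)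

S : ℕ → List Word → List Word
S n T = filter (λ π → all? (π avoids?_) T) (permutations n)

------------------------------------------------------------------------
-- Formal power series over ℤ, as coefficient sequences

Series : Set
Series = ℕ → ℤ

private
  constant : ℤ → Series
  constant c zero    = c
  constant c (suc _) = 0ℤ

  cauchy : Series → Series → Series
  cauchy f g n = foldr ℤ._+_ 0ℤ (applyUpTo (λ i → f i ℤ.* g (n ∸ i)) (suc n))

seriesRawRing : RawRing 0ℓ 0ℓ
seriesRawRing = record
  { Carrier = Series
  ; _≈_     = _≗_
  ; _+_     = λ f g n → f n ℤ.+ g n
  ; _*_     = cauchy
  ; -_      = λ f n → ℤ.- f n
  ; 0#      = constant 0ℤ
  ; 1#      = constant 1ℤ
  }

module PowerSeries where
  open RawRing seriesRawRing public using (_≈_; _+_; _*_; -_; 0#; 1#; rawSemiring)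
  open RawSemiringDefs rawSemiring public using (_^_) renaming (_×_ to _·_)

  infixl 6 _-_
  infixl 7 _/_

  _-_ : Series → Series → Series
  f - g = f + (- g)

  x : Series
  x 1 = 1ℤ
  x _ = 0ℤ

  -- Long division: writing f = f₀ + x f′ and g = 1 + x g′, we have
  -- f / g = f₀ + x ((f′ - f₀ g′) / g).
  longDivision : Series → Series → Series
  longDivision f g zero    = f 0
  longDivision f g (suc n) = longDivision (λ k → f (suc k) ℤ.- f 0 ℤ.* g (suc k)) g n

  _/_ : (f g : Series) → {True (g 0 ℤ.≟ 1ℤ)} → Series
  f / g = longDivision f g

  /-*-cancel : ∀ f g {g₀ : True (g 0 ℤ.≟ 1ℤ)} → (f / g) {g₀} * g ≈ f
  /-*-cancel f g {g₀} zero = begin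
    f 0 ℤ.* g 0 ℤ.+ 0ℤ  ≡⟨ ℤ.+-identityʳ _ ⟩
    f 0 ℤ.* g 0         ≡⟨ cong (f 0 ℤ.*_) (toWitness g₀) ⟩
    f 0 ℤ.* 1ℤ          ≡⟨ ℤ.*-identityʳ _ ⟩
    f 0                 ∎
    where open ≡-Reasoning
  /-*-cancel f g {g₀} (suc n) = begin
    a ℤ.+ ((f₁ / g) {g₀} * g) n    ≡⟨ cong (ℤ._+_ a) (/-*-cancel f₁ g {g₀} n) ⟩
    a ℤ.+ (f (suc n) ℤ.- a)        ≡⟨ ℤ.+-comm a _ ⟩
    f (suc n) ℤ.- a ℤ.+ a          ≡⟨ ℤ.+-assoc (f (suc n)) (ℤ.- a) a ⟩
    f (suc n) ℤ.+ (ℤ.- a ℤ.+ a)    ≡⟨ cong (ℤ._+_ (f (suc n))) (ℤ.+-inverseˡ a) ⟩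
    f (suc n) ℤ.+ 0ℤ               ≡⟨ ℤ.+-identityʳ _ ⟩
    f (suc n)                      ∎
    where
    open ≡-Reasoning
    a : ℤ
    a = f 0 ℤ.* g (suc n)
    f₁ : Series
    f₁ k = f (suc k) ℤ.- f 0 ℤ.* g (suc k)

F : List Word → Series
F T n = + length (S n T)

T : List Word
T = (2 ∷ 1 ∷ 4 ∷ 3 ∷ [])
  ∷ (2 ∷ 3 ∷ 4 ∷ 1 ∷ [])
  ∷ (4 ∷ 2 ∷ 3 ∷ 1 ∷ [])
  ∷ []

{-# OPTIONS --safe #-}

-- Let s be the first letter of a word w = s t avoiding T.  If s is the least
-- letter, then t is any T-avoiding word.  Otherwise consider the largest
-- letter N > s of t.  When t has another letter above s, N must stand first or
-- last in t; when N is the only one, it may also separate the lower letters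
-- into two nonempty parts u and v.  Placing N last imposes nothing, while
-- placing it first forces the rest of t to avoid 231.  Removing the higher
-- letters one by one thus leads to words avoiding 231 and 2143 and to splits
-- (u , v) of such words; both are again decomposed by their first letter.  The
-- resulting linear recurrences give the denominator.
--
-- Letters are listed in decreasing order, us ++ s ∷ vs, so that the largest
-- letter above s is the head of us.

module Submission where

open import Defs
open import Data.Empty using (⊥; ⊥-elim)
open import Data.Fin.Base using (zero; suc)
open import Data.Fin.Patterns
open import Data.Integer.Base as ℤ using (ℤ; 0ℤ; 1ℤ; +_; -[1+_])
import Data.Integer.Properties as ℤ
import Data.Integer.Tactic.RingSolver as ℤ
open import Data.List.Base
  using (List; []; _∷_; _++_; _∷ʳ_; [_]; length; map; applyDownFrom; initLast; _∷ʳ′_)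
open import Data.List.Membership.Propositional using (_∈_; _∉_)
open import Data.List.Membership.Propositional.Properties
  using (∈-++⁺ˡ; ∈-++⁺ʳ; ∈-++⁻; ∈-map⁺; ∈-map⁻; ∈-∃++; ∈-insert; ∈-filter⁺; ∈-filter⁻;
         ∈-cartesianProductWith⁺; ∈-cartesianProductWith⁻)
open import Data.List.Properties
  using (length-++; length-++-sucʳ; length-map; length-applyUpTo; length-applyDownFrom;
         reverse-applyUpTo; ++-assoc; ++-identityʳ; ++-conicalʳ;
         ∷-injective; ∷-injectiveˡ; ∷-injectiveʳ; ∷ʳ-injective; ∷ʳ-injectiveˡ)
open import Data.List.Relation.Binary.Permutation.Propositional
  using (_↭_; ↭-refl; ↭-sym; ↭-trans; ↭-prep; ↭⇒↭ₛ)
open import Data.List.Relation.Binary.Permutation.Propositional.Properties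
  using (∈-resp-↭; All-resp-↭; ↭-length; ↭-reverse; ↭-empty-inv; ↭-singleton-inv;
         shift; drop-mid; ∷↭∷ʳ)
import Data.List.Relation.Binary.Permutation.Setoid.Properties as SetoidPermutation
open import Data.List.Relation.Binary.Pointwise as Pointwise using (Pointwise; []; _∷_)
open import Data.List.Relation.Binary.Sublist.Propositional
  using (_⊆_; []; _∷_; ⊆-refl; ⊆-trans; to∈; from∈)
  renaming (_∷ʳ_ to skip)
open import Data.List.Relation.Binary.Sublist.Propositional.Properties
  using (++⁺; ++⁺ˡ; ++⁺ʳ; All-resp-⊆)
open import Data.List.Relation.Unary.All as All using (All; []; _∷_)
import Data.List.Relation.Unary.All.Properties as All
open import Data.List.Relation.Unary.AllPairs as AllPairs using (AllPairs; []; _∷_)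
import Data.List.Relation.Unary.AllPairs.Properties as AllPairs
open import Data.List.Relation.Unary.Any using (here; there)
open import Data.List.Relation.Unary.Unique.Propositional using (Unique)
import Data.List.Relation.Unary.Unique.Propositional.Properties as Unique
open import Data.Nat.Base as ℕ using (ℕ; zero; suc; _≤_; _<_; z≤n; s≤s; s≤s⁻¹)
import Data.Nat.Properties as ℕ
import Data.Nat.Tactic.RingSolver as ℕ
open import Data.Product.Base using (∃; ∃₂; _×_; _,_; proj₁; proj₂)
open import Data.Sum.Base as Sum using (_⊎_; inj₁; inj₂)
open import Function.Base using (_∘_; id)
open import Function.Bundles using (_⇔_; mk⇔; module Equivalence)
open import Relation.Binary.PropositionalEquality
  using (_≡_; _≢_; _≗_; refl; sym; trans; cong; cong₂; subst; setoid; module ≡-Reasoning)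
open import Relation.Nullary.Decidable using (True; toWitness)
open import Relation.Nullary.Negation using (¬_; contradiction)

-- Removing a letter from a permutation leaves an arbitrary set of letters. All counts are therefore
-- stated for every decreasing list of letters and depend only on lengths, so that nothing is ever
-- relabelled. The factors of the denominator stem from different choices. Words avoiding 231 and
-- 2143 are counted by odd-indexed Fibonacci numbers, whence 1 - 3x + x^2. The factor 1 - 2x records
-- a repeated binary choice, and such a choice occurs twice: a left part `u` with several letters
-- starts with the largest or the least letter, and in a tail avoiding 231 the largest letter may
-- stand at either end. Neither process feeds the other, so the factor appears only once. One factor
-- 1 - x comes from higher letters placed last, the other from removing a least head.

private variable
  A B      : Set
  P Q      : A → Set
  Pat      : Word → Set
  m n s N  : ℕ
  u v w zs : Word

-- Counting by enumeration

-- The leftover elements are returned as `zs`: their number gives the inequality of cardinalities,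
-- their absence an actual rearrangement.
unique-⊆⇒↭ : {xs ys : List A} → Unique xs → (∀ {x} → x ∈ xs → x ∈ ys) →
             ∃ λ zs → xs ++ zs ↭ ys
unique-⊆⇒↭ {xs = []}     {ys} _          _  = ys , ↭-refl
unique-⊆⇒↭ {xs = x ∷ xs} {ys} (x∉ ∷ xs!) ⊆ with ∈-∃++ (⊆ (here refl))
... | ys₁ , ys₂ , refl = let zs , p = unique-⊆⇒↭ xs! ⊆′ in
    zs , ↭-trans (↭-prep x p) (↭-sym (shift x ys₁ ys₂))
  where
  ⊆′ : ∀ {y} → y ∈ xs → y ∈ ys₁ ++ ys₂
  ⊆′ y∈ with ∈-++⁻ ys₁ (⊆ (there y∈))
  ... | inj₁ y∈₁         = ∈-++⁺ˡ y∈₁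
  ... | inj₂ (here refl) = ⊥-elim (All.lookup x∉ y∈ refl)
  ... | inj₂ (there y∈₂) = ∈-++⁺ʳ ys₁ y∈₂

-- A cardinality is witnessed by a list without repetitions. Since the predicate determines the
-- number (`count-functional`), the filtered list `S n T` and the recursive enumeration can be
-- compared although they list the words differently.
record Count (P : A → Set) (n : ℕ) : Set where
  field
    elements : List _
    unique   : Unique elements
    sound    : ∀ {x} → x ∈ elements → P x
    complete : ∀ {x} → P x → x ∈ elements
    size     : length elements ≡ n

count-≤ : (∀ {x} → P x → Q x) → Count P m → Count Q n → m ≤ n
count-≤ {m = m} {n} P⇒Q p q = let zs , p↭q = unique-⊆⇒↭ P.unique (Q.complete ∘ P⇒Q ∘ P.sound) in
  begin
    m                                ≡⟨ P.size ⟨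
    length P.elements                ≤⟨ ℕ.m≤m+n _ _ ⟩
    length P.elements ℕ.+ length zs  ≡⟨ length-++ P.elements ⟨
    length (P.elements ++ zs)        ≡⟨ ↭-length p↭q ⟩
    length Q.elements                ≡⟨ Q.size ⟩
    n                                ∎
  where
  open ℕ.≤-Reasoning
  module P = Count p
  module Q = Count q

count-functional : Count P m → Count P n → m ≡ n
count-functional p q = ℕ.≤-antisym (count-≤ id p q) (count-≤ id q p)

count-⇔ : (∀ {x} → P x → Q x) → (∀ {x} → Q x → P x) → Count P n → Count Q n
count-⇔ P⇒Q Q⇒P p = record
  { elements = elements
  ; unique   = unique
  ; sound    = P⇒Q ∘ sound
  ; complete = complete ∘ Q⇒P
  ; size     = size
  }
  where open Count p

count-∅ : (∀ {x} → ¬ P x) → Count P 0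
count-∅ ¬P = record
  { elements = [] ; unique = [] ; sound = λ () ; complete = ⊥-elim ∘ ¬P ; size = refl }

count-[_] : (a : A) → Count (_≡ a) 1
count-[ a ] = record
  { elements = [ a ] ; unique = [] ∷ [] ; sound = λ { (here eq) → eq } ; complete = here ; size = refl }

count-⊎ : Count P m → Count Q n → (∀ {x} → P x → Q x → ⊥) → Count (λ x → P x ⊎ Q x) (m ℕ.+ n)
count-⊎ p q disjoint = record
  { elements = P.elements ++ Q.elements
  ; unique   = Unique.++⁺ P.unique Q.unique λ (x∈p , x∈q) → disjoint (P.sound x∈p) (Q.sound x∈q)
  ; sound    = λ x∈ → Sum.[ inj₁ ∘ P.sound , inj₂ ∘ Q.sound ] (∈-++⁻ P.elements x∈)
  ; complete = Sum.[ ∈-++⁺ˡ ∘ P.complete , ∈-++⁺ʳ P.elements ∘ Q.complete ]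
  ; size     = trans (length-++ P.elements) (cong₂ ℕ._+_ P.size Q.size)
  }
  where
  module P = Count p
  module Q = Count q

unique-map : (f : A → B) → (∀ {x y} → P x → P y → f x ≡ f y → x ≡ y) →
             ∀ {xs} → All P xs → Unique xs → Unique (map f xs)
unique-map f inj ps xs! = AllPairs.map⁺ (go ps xs!)
  where
  go : ∀ {xs} → All _ xs → Unique xs → AllPairs (λ x y → f x ≢ f y) xs
  go []       []         = []
  go (p ∷ ps) (x∉ ∷ xs!) =
    All.zipWith (λ (x≢y , q) fx≡fy → x≢y (inj p q fx≡fy)) (x∉ , ps) ∷ go ps xs!

count-map : (f : A → B) → (∀ {x y} → P x → P y → f x ≡ f y → x ≡ y) →
            Count P n → Count (λ y → ∃ λ x → P x × y ≡ f x) n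
count-map f inj p = record
  { elements = map f elements
  ; unique   = unique-map f inj (All.tabulate sound) unique
  ; sound    = λ y∈ → let x , x∈ , eq = ∈-map⁻ f y∈ in x , sound x∈ , eq
  ; complete = λ { (x , px , refl) → ∈-map⁺ f (complete px) }
  ; size     = trans (length-map f elements) size
  }
  where open Count p

Decreasing : Word → Set
Decreasing = AllPairs λ x y → y < x

sumSplits : (ℕ → ℕ → ℕ) → ℕ → ℕ → ℕ
sumSplits f i zero    = 0
sumSplits f i (suc j) = f i j ℕ.+ sumSplits f (suc i) j

-- The heads partition the words, and `f` sees only how many letters of `zs` precede and follow the
-- head: in a decreasing list, the numbers of higher and lower letters. For empty `zs` the empty
-- word would escape the sum.
count-byHead : ∀ {Q : Word → Set} {f} zs → zs ≢ [] → Unique zs →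
  (∀ us s vs → zs ≡ us ++ s ∷ vs → Count (λ w → w ↭ us ++ vs × Q (s ∷ w)) (f (length us) (length vs))) →
  Count (λ w → w ↭ zs × Q w) (sumSplits f 0 (length zs))
count-byHead {Q} {f} zs zs≢[] zs! byHead = count-⇔
  (λ { (_ , s , _ , _ , refl , refl , p , q) → ↭-trans (↭-prep s p) (↭-sym (shift s _ _)) , q })
  (λ { {[]}    (p , _) → ⊥-elim (zs≢[] (↭-empty-inv (↭-sym p)))
     ; {s ∷ t} (p , q) → let us , vs , eq = ∈-∃++ (∈-resp-↭ p (here refl)) in
       us , s , vs , t , eq , refl , drop-mid [] us (subst (s ∷ t ↭_) eq p) , q })
  (go [] zs refl)
  where
  -- `ps` holds the letters already passed and the head lies in `rest`; the tail still rearranges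
  -- all of `zs` but the head.
  From : Word → Word → Word → Set
  From ps rest w = ∃ λ us → ∃ λ s → ∃ λ vs → ∃ λ t →
    rest ≡ us ++ s ∷ vs × w ≡ s ∷ t × t ↭ (ps ++ us) ++ vs × Q (s ∷ t)
  go : ∀ ps rest → zs ≡ ps ++ rest → Count (From ps rest) (sumSplits f (length ps) (length rest))
  go ps []         _  = count-∅ λ { ([] , _ , _ , _ , () , _) ; (_ ∷ _ , _ , _ , _ , () , _) }
  go ps (s ∷ rest) eq = count-⇔
    (λ { (inj₁ (t , (p , q) , refl)) →
           [] , s , rest , t , refl , refl , subst (λ l → t ↭ l ++ rest) (sym (++-identityʳ ps)) p , q
       ; (inj₂ (us , s′ , vs , t , refl , refl , p , q)) →
           s ∷ us , s′ , vs , t , refl , refl , subst (λ l → t ↭ l ++ vs) (++-assoc ps [ s ] us) p , q })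
    (λ { ([] , _ , _ , t , refl , refl , p , q) →
           inj₁ (t , (subst (λ l → t ↭ l ++ rest) (++-identityʳ ps) p , q) , refl)
       ; (_ ∷ us , s′ , vs , t , refl , refl , p , q) →
           inj₂ (us , s′ , vs , t , refl , refl , subst (λ l → t ↭ l ++ vs) (sym (++-assoc ps [ s ] us)) p , q) })
    (count-⊎ (count-map (s ∷_) (λ _ _ → ∷-injectiveʳ) (byHead ps s rest eq))
      (subst (λ l → Count (From (ps ∷ʳ s) rest) (sumSplits f l (length rest)))
        (trans (length-++ ps) (ℕ.+-comm _ 1))
        (go (ps ∷ʳ s) rest (trans eq (sym (++-assoc ps [ s ] rest)))))
      λ { (_ , _ , refl) (us , _ , vs , _ , eq′ , refl , _) →
            s∉ ps (subst Unique eq zs!) (subst (s ∈_) (sym eq′) (∈-insert us)) })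
    where
    s∉ : ∀ ps → Unique (ps ++ s ∷ rest) → s ∉ rest
    s∉ []       (s∉ ∷ _) s∈ = All.lookup s∉ s∈ refl
    s∉ (_ ∷ ps) (_ ∷ u)     = s∉ ps u

Inner : (Word × Word → Set) → Word × Word → Set
Inner R (u , v) = u ≢ [] × v ≢ [] × R (u , v)

∈-∷ʳ : ∀ (w : Word) {N} → N ∈ w ∷ʳ N
∈-∷ʳ w = ∈-++⁺ʳ w (here refl)

-- As `N` is not in `zs`, a word over `N ∷ zs` determines the two sides of `N`. Nonempty sides in
-- the middle case, together with a nonempty `zs`, keep the first, last and middle positions apart.
count-byLetter : ∀ {Q : Word → Set} {p q r} zs N → zs ≢ [] → N ∉ zs →
  Count (λ w → w ↭ zs × Q (N ∷ w)) p →
  Count (λ w → w ↭ zs × Q (w ∷ʳ N)) q →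
  Count (Inner λ (u , v) → u ++ v ↭ zs × Q (u ++ N ∷ v)) r →
  Count (λ w → w ↭ N ∷ zs × Q w) (p ℕ.+ (q ℕ.+ r))
count-byLetter {Q} zs N zs≢[] N∉zs front back inner = count-⇔
  (λ { (inj₁ (w , (p , q) , refl)) → ↭-prep N p , q
     ; (inj₂ (inj₁ (w , (p , q) , refl))) → ↭-trans (↭-sym (∷↭∷ʳ N w)) (↭-prep N p) , q
     ; (inj₂ (inj₂ ((u , v) , (_ , _ , p , q) , refl))) → ↭-trans (shift N u v) (↭-prep N p) , q })
  (λ (p , q) → let u , v , eq = ∈-∃++ (∈-resp-↭ (↭-sym p) (here refl)) in
     position u v eq (drop-mid u [] (subst (_↭ N ∷ zs) eq p)) q)
  (count-⊎ (count-map (N ∷_) (λ _ _ → ∷-injectiveʳ) front)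
    (count-⊎ (count-map (_∷ʳ N) (λ _ _ → ∷ʳ-injectiveˡ _ _) back)
      (count-map (λ (u , v) → u ++ N ∷ v)
        (λ { (_ , _ , p , _) (_ , _ , q , _) eq →
             let e₁ , e₂ = split (N∉ p ∘ ∈-++⁺ˡ) (N∉ q ∘ ∈-++⁺ˡ) eq in cong₂ _,_ e₁ e₂ })
        inner)
      (λ { (_ , (p , _) , refl) ((u , v) , (_ , v≢[] , p′ , _) , eq) →
           v≢[] (sym (proj₂ (split {v = []} (N∉ p) (N∉ p′ ∘ ∈-++⁺ˡ) eq))) }))
    (λ { (w , (p , _) , refl) (inj₁ (w′ , (p′ , _) , eq)) →
           let []≡w′ , _ = split {u = []} {v′ = []} (λ ()) (N∉ p′) eq in
           zs≢[] (↭-empty-inv (↭-sym (subst (_↭ zs) (sym []≡w′) p′)))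
       ; (w , (p , _) , refl) (inj₂ ((u , v) , (u≢[] , _ , p′ , _) , eq)) →
           u≢[] (sym (proj₁ (split {u = []} (λ ()) (N∉ p′ ∘ ∈-++⁺ˡ) eq))) }))
  where
  N∉ : ∀ {w} → w ↭ zs → N ∉ w
  N∉ p = N∉zs ∘ ∈-resp-↭ p
  split : ∀ {u v u′ v′ : Word} → N ∉ u → N ∉ u′ → u ++ N ∷ v ≡ u′ ++ N ∷ v′ → u ≡ u′ × v ≡ v′
  split {[]}    {u′ = []}     _  _  refl = refl , refl
  split {[]}    {u′ = _ ∷ _}  _  ∉  refl = ⊥-elim (∉ (here refl))
  split {_ ∷ _} {u′ = []}     ∉  _  refl = ⊥-elim (∉ (here refl))
  split {_ ∷ _} {u′ = _ ∷ _} ∉u ∉u′ eq with refl ← ∷-injectiveˡ eq =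
    let e₁ , e₂ = split (∉u ∘ there) (∉u′ ∘ there) (∷-injectiveʳ eq) in cong (_ ∷_) e₁ , e₂
  position : ∀ u v {w} → w ≡ u ++ N ∷ v → u ++ v ↭ zs → Q w →
    (∃ λ t → (t ↭ zs × Q (N ∷ t)) × w ≡ N ∷ t) ⊎
    ((∃ λ t → (t ↭ zs × Q (t ∷ʳ N)) × w ≡ t ∷ʳ N) ⊎
     (∃ λ x → Inner (λ (u , v) → u ++ v ↭ zs × Q (u ++ N ∷ v)) x × w ≡ proj₁ x ++ N ∷ proj₂ x))
  position []         v         refl p q = inj₁ (v , (p , q) , refl)
  position u@(_ ∷ _)  []        refl p q = inj₂ (inj₁ (u , (subst (_↭ zs) (++-identityʳ u) p , q) , refl))
  position u@(_ ∷ _)  v@(_ ∷ _) refl p q = inj₂ (inj₂ ((u , v) , ((λ ()) , (λ ()) , p , q) , refl))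

-- Pattern avoidance

-- Patterns are given by a chain of inequalities, so that matching on `mk` supplies them and a word
-- of the wrong length is absurd.
data P231 : Word → Set where
  mk : ∀ {a b c} → a < b → b < c → P231 (b ∷ c ∷ a ∷ [])

data P2143 : Word → Set where
  mk : ∀ {a b c d} → a < b → b < c → c < d → P2143 (b ∷ a ∷ d ∷ c ∷ [])

data P2341 : Word → Set where
  mk : ∀ {a b c d} → a < b → b < c → c < d → P2341 (b ∷ c ∷ d ∷ a ∷ [])

data P4231 : Word → Set where
  mk : ∀ {a b c d} → a < b → b < c → c < d → P4231 (d ∷ b ∷ c ∷ a ∷ [])

Avoid : (Word → Set) → Word → Set
Avoid P w = ∀ {σ} → σ ⊆ w → ¬ P σ

AvoidC AvoidT : Word → Set
AvoidC w = Avoid P231 w × Avoid P2143 w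
AvoidT w = Avoid P2143 w × Avoid P2341 w × Avoid P4231 w

avoid-⊆ : u ⊆ v → Avoid Pat v → Avoid Pat u
avoid-⊆ u⊆v av σ⊆u = av (⊆-trans σ⊆u u⊆v)

avoidC-⊆ : u ⊆ v → AvoidC v → AvoidC u
avoidC-⊆ p (a , b) = avoid-⊆ p a , avoid-⊆ p b

avoidT-⊆ : u ⊆ v → AvoidT v → AvoidT u
avoidT-⊆ p (a , b , c) = avoid-⊆ p a , avoid-⊆ p b , avoid-⊆ p c

tail-⊆ : w ⊆ s ∷ w
tail-⊆ = skip _ ⊆-refl

delete-⊆ : ∀ u → u ++ v ⊆ u ++ N ∷ v
delete-⊆ u = ++⁺ (⊆-refl {x = u}) tail-⊆

init-⊆ : ∀ w → w ⊆ w ∷ʳ N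
init-⊆ w = ++⁺ʳ _ ⊆-refl

avoid-∷ : Avoid Pat w → (∀ {σ} → σ ⊆ w → ¬ Pat (s ∷ σ)) → Avoid Pat (s ∷ w)
avoid-∷ av _    (skip _ p)    = av p
avoid-∷ _  head (refl ∷ p) = head p

⊆-insert : ∀ (u : Word) {v : Word} {N σ} → σ ⊆ u ++ N ∷ v →
           σ ⊆ u ++ v ⊎ ∃₂ λ (σ₁ σ₂ : Word) → σ ≡ σ₁ ++ N ∷ σ₂ × σ₁ ⊆ u × σ₂ ⊆ v
⊆-insert []      (skip _ p)   = inj₁ p
⊆-insert []      (refl ∷ p) = inj₂ ([] , _ , refl , [] , p)
⊆-insert (x ∷ u) (skip _ p)   with ⊆-insert u p
... | inj₁ q                       = inj₁ (skip x q)
... | inj₂ (_ , _ , refl , q₁ , q₂) = inj₂ (_ , _ , refl , skip x q₁ , q₂)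
⊆-insert (x ∷ u) (refl ∷ p) with ⊆-insert u p
... | inj₁ q                       = inj₁ (refl ∷ q)
... | inj₂ (_ , _ , refl , q₁ , q₂) = inj₂ (_ , _ , refl , refl ∷ q₁ , q₂)

-- An occurrence that does not use `N` survives its deletion, so only those through `N` are left to
-- refute.
avoid-insert : ∀ (u : Word) → Avoid Pat (u ++ v) →
  (∀ σ₁ σ₂ → σ₁ ⊆ u → σ₂ ⊆ v → ¬ Pat (σ₁ ++ N ∷ σ₂)) → Avoid Pat (u ++ N ∷ v)
avoid-insert u av mid p with ⊆-insert u p
... | inj₁ q                              = av q
... | inj₂ (σ₁ , σ₂ , refl , q₁ , q₂) = mid σ₁ σ₂ q₁ q₂

module _ {s : ℕ} {w : Word} (s<w : All (s <_) w) where
  private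
    s< : ∀ {x σ} → x ∷ σ ⊆ w → x < s → ⊥
    s< p x<s = ℕ.<-asym x<s (All.lookup s<w (to∈ p))

  -- A letter below all others could start an occurrence only as its 1, and none of the four
  -- patterns begins with its least letter.
  avoid231-min-∷ : Avoid P231 w → Avoid P231 (s ∷ w)
  avoid231-min-∷ av = avoid-∷ av λ { p (mk a<b _) → s< (⊆-trans tail-⊆ p) a<b }

  avoidC-min-∷ : AvoidC w → AvoidC (s ∷ w)
  avoidC-min-∷ (a , b) = avoid231-min-∷ a , avoid-∷ b λ { p (mk a<b _ _) → s< p a<b }

  avoidT-min-∷ : AvoidT w → AvoidT (s ∷ w)
  avoidT-min-∷ (a , b , c) =
    avoid-∷ a (λ { p (mk a<b _ _) → s< p a<b }) ,
    avoid-∷ b (λ { p (mk a<b _ _) → s< (⊆-trans (skip _ tail-⊆) p) a<b }) ,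
    avoid-∷ c (λ { p (mk _ _ c<d) → s< (⊆-trans tail-⊆ p) c<d })

module _ {s : ℕ} {w : Word} (w<s : All (_< s) w) where
  private
    <s : ∀ {x σ} → x ∷ σ ⊆ w → s < x → ⊥
    <s p s<x = ℕ.<-asym s<x (All.lookup w<s (to∈ p))

  avoidC-max-∷ : AvoidC w → AvoidC (s ∷ w)
  avoidC-max-∷ (a , b) =
    avoid-∷ a (λ { p (mk _ b<c) → <s p b<c }) ,
    avoid-∷ b (λ { p (mk _ b<c c<d) → <s (⊆-trans (skip _ tail-⊆) p) b<c })

  -- A largest head can play only the 4 of 4231, which a following 231 completes. Inside `w`, both
  -- 2341 and 4231 already contain a 231, so `AvoidC` is all that remains of `AvoidT`.
  avoidT-max-∷ : AvoidC w → AvoidT (s ∷ w)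
  avoidT-max-∷ (a , b) =
    avoid-∷ b (λ { p (mk _ b<c c<d) → <s (⊆-trans (skip _ tail-⊆) p) b<c }) ,
    avoid-∷ {Pat = P2341} (λ { p (mk a<b b<c c<d) → a (⊆-trans tail-⊆ p) (mk (ℕ.<-trans a<b b<c) c<d) })
            (λ { p (mk _ b<c _) → <s p b<c }) ,
    avoid-∷ {Pat = P4231} (λ { p (mk a<b b<c _) → a (⊆-trans tail-⊆ p) (mk a<b b<c) })
            (λ { p (mk a<b b<c _) → a p (mk a<b b<c) })

  avoidT-max-∷⁻ : AvoidT (s ∷ w) → AvoidC w
  avoidT-max-∷⁻ (a , _ , c) =
    (λ { p (mk a<b b<c) → c (refl ∷ p) (mk a<b b<c (All.lookup w<s (to∈ (⊆-trans tail-⊆ p)))) }) ,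
    avoid-⊆ tail-⊆ a

module _ {N : ℕ} {u v : Word} (u<N : All (_< N) u) (v<N : All (_< N) v) where
  private
    u≮ : ∀ {x σ} → x ∷ σ ⊆ u → N < x → ⊥
    u≮ p N<x = ℕ.<-asym N<x (All.lookup u<N (to∈ p))
    v≮ : ∀ {x σ} → x ∷ σ ⊆ v → N < x → ⊥
    v≮ p N<x = ℕ.<-asym N<x (All.lookup v<N (to∈ p))

  -- The length of `σ₁` decides which letter of the pattern `N` plays. Unless that is the largest
  -- one, some letter of `u` or `v` would exceed `N`. The three lemmas below follow the same scheme.
  avoid231-insert-max : Avoid P231 (u ++ v) → (∀ {b a} → b ∈ u → a ∈ v → a < b → ⊥) →
                        Avoid P231 (u ++ N ∷ v)
  avoid231-insert-max av ⊥231 = avoid-insert u av λ where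
    []                      _ _ q (mk _ b<c)   → v≮ q b<c
    (_ ∷ [])                _ p q (mk a<b _)   → ⊥231 (to∈ p) (to∈ q) a<b
    (_ ∷ _ ∷ [])            _ p q (mk a<b _)   → u≮ p a<b
    (_ ∷ _ ∷ _ ∷ [])        _ p q ()
    (_ ∷ _ ∷ _ ∷ _ ∷ _)     _ p q ()

  avoid2143-insert-max : Avoid P2143 (u ++ v) →
    (∀ {b a c} → b ∷ a ∷ [] ⊆ u → c ∈ v → a < b → b < c → ⊥) → Avoid P2143 (u ++ N ∷ v)
  avoid2143-insert-max av ⊥2143 = avoid-insert u av λ where
    []                      _ _ q (mk _ b<c c<d)   → v≮ (⊆-trans tail-⊆ q) (ℕ.<-trans b<c c<d)
    (_ ∷ [])                _ p q (mk a<b _ _)     → u≮ p a<b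
    (_ ∷ _ ∷ [])            _ p q (mk a<b b<c _)   → ⊥2143 p (to∈ q) a<b b<c
    (_ ∷ _ ∷ _ ∷ [])        _ p q (mk _ _ c<d)     → u≮ (⊆-trans (skip _ tail-⊆) p) c<d
    (_ ∷ _ ∷ _ ∷ _ ∷ [])    _ p q ()
    (_ ∷ _ ∷ _ ∷ _ ∷ _ ∷ _) _ p q ()

  avoid2341-insert-max : Avoid P2341 (u ++ v) →
    (∀ {b c a} → b ∷ c ∷ [] ⊆ u → a ∈ v → a < b → b < c → ⊥) → Avoid P2341 (u ++ N ∷ v)
  avoid2341-insert-max av ⊥2341 = avoid-insert u av λ where
    []                      _ _ q (mk _ b<c _)     → v≮ q b<c
    (_ ∷ [])                _ p q (mk _ _ c<d)     → v≮ q c<d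
    (_ ∷ _ ∷ [])            _ p q (mk a<b b<c _)   → ⊥2341 p (to∈ q) a<b b<c
    (_ ∷ _ ∷ _ ∷ [])        _ p q (mk a<b _ _)     → u≮ p a<b
    (_ ∷ _ ∷ _ ∷ _ ∷ [])    _ p q ()
    (_ ∷ _ ∷ _ ∷ _ ∷ _ ∷ _) _ p q ()

  avoid4231-insert-max : Avoid P4231 (u ++ v) → Avoid P231 v → Avoid P4231 (u ++ N ∷ v)
  avoid4231-insert-max av av231 = avoid-insert u av λ where
    []                      _ _ q (mk a<b b<c _)   → av231 q (mk a<b b<c)
    (_ ∷ [])                _ p q (mk _ b<c c<d)   → u≮ p (ℕ.<-trans b<c c<d)
    (_ ∷ _ ∷ [])            _ p q (mk _ _ c<d)     → u≮ p c<d
    (_ ∷ _ ∷ _ ∷ [])        _ p q (mk a<b b<c c<d) → u≮ (⊆-trans tail-⊆ p) a<b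
    (_ ∷ _ ∷ _ ∷ _ ∷ [])    _ p q ()
    (_ ∷ _ ∷ _ ∷ _ ∷ _ ∷ _) _ p q ()

module _ {N : ℕ} where
  private
    ++[]⁺ : ∀ {u} → Avoid Pat u → Avoid Pat (u ++ [])
    ++[]⁺ {Pat} {u} = subst (Avoid Pat) (sym (++-identityʳ u))

  -- In each of the four patterns some letter follows the largest one, so a new maximum at the end
  -- completes no occurrence.
  avoid231-∷ʳ-max : ∀ {u} → All (_< N) u → Avoid P231 u → Avoid P231 (u ∷ʳ N)
  avoid231-∷ʳ-max u<N a = avoid231-insert-max u<N [] (++[]⁺ a) λ _ ()

  avoid2143-∷ʳ-max : ∀ {u} → All (_< N) u → Avoid P2143 u → Avoid P2143 (u ∷ʳ N)
  avoid2143-∷ʳ-max u<N a = avoid2143-insert-max u<N [] (++[]⁺ a) λ _ ()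

  avoidC-∷ʳ-max : ∀ {u} → All (_< N) u → AvoidC u → AvoidC (u ∷ʳ N)
  avoidC-∷ʳ-max u<N (a , b) = avoid231-∷ʳ-max u<N a , avoid2143-∷ʳ-max u<N b

  avoidT-∷ʳ-max : ∀ {u} → All (_< N) u → AvoidT u → AvoidT (u ∷ʳ N)
  avoidT-∷ʳ-max u<N (a , b , c) =
    avoid2143-∷ʳ-max u<N a ,
    avoid2341-insert-max u<N [] (++[]⁺ b) (λ _ ()) ,
    avoid4231-insert-max u<N [] (++[]⁺ c) λ { [] () }

-- Letters above and below a chosen letter

decreasing-unique : Decreasing zs → Unique zs
decreasing-unique = AllPairs.map λ y<x x≡y → ℕ.<⇒≢ y<x (sym x≡y)

decreasing-prefix : ∀ us {vs} → Decreasing (us ++ vs) → Decreasing us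
decreasing-prefix []       _         = []
decreasing-prefix (_ ∷ us) (px ∷ ds) = All.++⁻ˡ us px ∷ decreasing-prefix us ds

decreasing-suffix : ∀ us {vs} → Decreasing (us ++ vs) → Decreasing vs
decreasing-suffix []       ds       = ds
decreasing-suffix (_ ∷ us) (_ ∷ ds) = decreasing-suffix us ds

above : ∀ us {vs} → Decreasing (us ++ s ∷ vs) → All (s <_) us
above []       _         = []
above (_ ∷ us) (px ∷ ds) = All.head (All.++⁻ʳ us px) ∷ above us ds

below : ∀ us {vs} → Decreasing (us ++ s ∷ vs) → All (_< s) vs
below us ds = AllPairs.head (decreasing-suffix us ds)

delete-All : ∀ {P : ℕ → Set} us {vs} → All P (us ++ s ∷ vs) → All P (us ++ vs)
delete-All us = All-resp-⊆ (delete-⊆ us)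

∈-nonempty : u ≢ [] → ∃ (_∈ u)
∈-nonempty {[]}    u≢[] = ⊥-elim (u≢[] refl)
∈-nonempty {x ∷ _} _    = x , here refl

insert-∈ : ∀ (u : Word) {v x} → x ∈ v → N ∷ x ∷ [] ⊆ u ++ N ∷ v
insert-∈ u x∈ = ++⁺ˡ u (refl ∷ from∈ x∈)

∈-insert-∈ : ∀ {u v : Word} {x y} → x ∈ u → y ∈ v → x ∷ N ∷ y ∷ [] ⊆ u ++ N ∷ v
∈-insert-∈ x∈ y∈ = ++⁺ (from∈ x∈) (refl ∷ from∈ y∈)

-- Words avoiding 231 and 2143

-- For positive n these are the Fibonacci numbers of index 2n - 1 and 2n; `sumC n` adds up `numC 1`
-- to `numC n`.
numC sumC : ℕ → ℕ
numC zero    = 1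
numC (suc n) = numC n ℕ.+ sumC n
sumC zero    = 0
sumC (suc n) = sumC n ℕ.+ numC (suc n)

-- The arguments are the numbers of letters above and below the head. Once a lower letter is
-- present, the higher ones leave no choice.
cByHead : ℕ → ℕ → ℕ
cByHead i zero    = numC i
cByHead i (suc j) = numC (suc j)

sum-cByHead : ∀ i j → sumSplits cByHead i (suc j) ≡ numC (i ℕ.+ j) ℕ.+ sumC j
sum-cByHead i zero    = cong (λ k → numC k ℕ.+ 0) (sym (ℕ.+-identityʳ i))
sum-cByHead i (suc j) = begin
  numC (suc j) ℕ.+ sumSplits cByHead (suc i) (suc j)
    ≡⟨ cong (numC (suc j) ℕ.+_) (sum-cByHead (suc i) j) ⟩
  numC (suc j) ℕ.+ (numC (suc i ℕ.+ j) ℕ.+ sumC j)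
    ≡⟨ regroup (numC (suc j)) (numC (suc i ℕ.+ j)) (sumC j) ⟩
  numC (suc i ℕ.+ j) ℕ.+ sumC (suc j)
    ≡⟨ cong (λ k → numC k ℕ.+ sumC (suc j)) (ℕ.+-suc i j) ⟨
  numC (i ℕ.+ suc j) ℕ.+ sumC (suc j) ∎
  where
  open ≡-Reasoning
  regroup : ∀ k l m → k ℕ.+ (l ℕ.+ m) ≡ l ℕ.+ (m ℕ.+ k)
  regroup = ℕ.solve-∀

-- With both lower and higher letters present, the maximum N can only come last.
avoidC-max-last : ∀ {us vs} → All (s <_) us → All (_< s) vs → vs ≢ [] → s < N → All (_< N) us →
  ∀ u {v} → v ≢ [] → u ++ v ↭ us ++ vs → ¬ AvoidC (s ∷ u ++ N ∷ v)
avoidC-max-last {us = us} s<us vs<s vs≢[] s<N us<N u v≢[] p (av231 , av2143)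
  with z , z∈v ← ∈-nonempty v≢[] | l , l∈vs ← ∈-nonempty vs≢[]
  with ∈-++⁻ us (∈-resp-↭ p (∈-++⁺ʳ u z∈v)) | ∈-++⁻ u (∈-resp-↭ (↭-sym p) (∈-++⁺ʳ us l∈vs))
... | inj₂ z∈vs | _        = av231 (refl ∷ insert-∈ u z∈v) (mk (All.lookup vs<s z∈vs) s<N)
... | inj₁ z∈us | inj₂ l∈v = av231 (refl ∷ insert-∈ u l∈v) (mk (All.lookup vs<s l∈vs) s<N)
... | inj₁ z∈us | inj₁ l∈u = av2143 (refl ∷ ∈-insert-∈ l∈u z∈v)
  (mk (All.lookup vs<s l∈vs) (All.lookup s<us z∈us) (All.lookup us<N z∈us))

IsC : Word → Word → Set
IsC zs w = w ↭ zs × AvoidC w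

++-≢[] : ∀ (us : Word) {vs : Word} → vs ≢ [] → us ++ vs ≢ []
++-≢[] us vs≢[] eq = vs≢[] (++-conicalʳ us _ eq)

max∉ : All (_< N) w → N ∉ w
max∉ w<N N∈w = ℕ.<-irrefl refl (All.lookup w<N N∈w)

-- Peeled from the largest down, each higher letter is forced to the end by `avoidC-max-last`, until
-- `s` exceeds everything left. The front and middle positions contribute 0.
count-tailC : ∀ us s vs {n} → vs ≢ [] → Decreasing (us ++ s ∷ vs) → Count (IsC vs) n →
  Count (λ w → w ↭ us ++ vs × AvoidC (s ∷ w)) n
count-tailC [] s vs vs≢[] (vs<s ∷ _) ih = count-⇔
  (λ (p , av) → p , avoidC-max-∷ (All-resp-↭ (↭-sym p) vs<s) av)
  (λ (p , av) → p , avoidC-⊆ tail-⊆ av) ih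
count-tailC (N ∷ us) s vs {n} vs≢[] (zs<N ∷ ds) ih = subst (Count _) (ℕ.+-identityʳ n)
  (count-byLetter (us ++ vs) N (++-≢[] us vs≢[]) (max∉ rest<N)
  (count-∅ λ { {[]} (p , _) → ++-≢[] us vs≢[] (↭-empty-inv (↭-sym p))
             ; {_ ∷ _} (p , av) → max-last [] (λ ()) p av })
  (count-⇔
    (λ (p , av) → p , avoidC-∷ʳ-max (s<N ∷ All-resp-↭ (↭-sym p) rest<N) av)
    (λ (p , av) → p , avoidC-⊆ (init-⊆ _) av)
    (count-tailC us s vs vs≢[] ds ih))
  (count-∅ λ { {u , _} (_ , v≢[] , p , av) → max-last u v≢[] p av }))
  where
  rest<N = delete-All us zs<N
  s<N = All.head (All.++⁻ʳ us zs<N)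
  max-last : ∀ u {v} → v ≢ [] → u ++ v ↭ us ++ vs → ¬ AvoidC (s ∷ u ++ N ∷ v)
  max-last = avoidC-max-last (above us ds) (below us ds) vs≢[] s<N (All.++⁻ˡ us zs<N)

avoidC-[] : AvoidC []
avoidC-[] = (λ { [] () }) , λ { [] () }

avoidT-[] : AvoidT []
avoidT-[] = (λ { [] () }) , (λ { [] () }) , λ { [] () }

count-[]↭ : ∀ {Q : Word → Set} → Q [] → Count (λ w → w ↭ [] × Q w) 1
count-[]↭ q = count-⇔ (λ { refl → ↭-refl , q }) (λ (p , _) → ↭-empty-inv p) count-[ [] ]

length-prefix : ∀ (us : Word) {s vs k} → length (us ++ s ∷ vs) ≤ suc k → length us ≤ k
length-prefix us {s} {vs} {k} le = s≤s⁻¹ (begin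
  suc (length us)                 ≤⟨ s≤s (ℕ.m≤m+n _ _) ⟩
  suc (length us ℕ.+ length vs)   ≡⟨ cong suc (length-++ us) ⟨
  suc (length (us ++ vs))         ≡⟨ length-++-sucʳ us s vs ⟨
  length (us ++ s ∷ vs)           ≤⟨ le ⟩
  suc k                           ∎)
  where open ℕ.≤-Reasoning

length-suffix : ∀ (us : Word) {s vs k} → length (us ++ s ∷ vs) ≤ suc k → length vs ≤ k
length-suffix us {s} {vs} {k} le = s≤s⁻¹ (begin
  suc (length vs)                 ≤⟨ ℕ.m≤n+m _ (length us) ⟩
  length us ℕ.+ suc (length vs)   ≡⟨ length-++ us ⟨
  length (us ++ s ∷ vs)           ≤⟨ le ⟩
  suc k                           ∎)
  where open ℕ.≤-Reasoning

count-C : ∀ zs → Decreasing zs → Count (IsC zs) (numC (length zs))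
count-C zs = go (length zs) zs ℕ.≤-refl
  where
  -- `k` bounds the recursion depth: `us` and `vs` come from an equation and are not structural
  -- subterms of `zs`.
  go : ∀ k zs → length zs ≤ k → Decreasing zs → Count (IsC zs) (numC (length zs))
  go _       []            _  _  = count-[]↭ avoidC-[]
  go (suc k) zs@(_ ∷ zs′) le ds = subst (Count (IsC zs)) (sum-cByHead 0 (length zs′))
    (count-byHead {f = cByHead} zs (λ ()) (decreasing-unique ds) byHead)
    where
    byHead : ∀ us s vs → zs ≡ us ++ s ∷ vs →
             Count (λ w → w ↭ us ++ vs × AvoidC (s ∷ w)) (cByHead (length us) (length vs))
    byHead us s [] eq = count-⇔
      (λ (p , av) → subst (_ ↭_) (sym (++-identityʳ us)) p ,
        avoidC-min-∷ (All-resp-↭ (↭-sym p) (above us ds′)) av)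
      (λ (p , av) → subst (_ ↭_) (++-identityʳ us) p , avoidC-⊆ tail-⊆ av)
      (go k us (length-prefix us (subst (λ z → length z ≤ suc k) eq le)) (decreasing-prefix us ds′))
      where ds′ = subst Decreasing eq ds
    byHead us s vs@(_ ∷ _) eq = count-tailC us s vs (λ ()) ds′
      (go k vs (length-suffix us (subst (λ z → length z ≤ suc k) eq le))
        (AllPairs.tail (decreasing-suffix us ds′)))
      where ds′ = subst Decreasing eq ds

-- Splits of such words around a larger letter

-- (u , v) stands for the word u N v, where N exceeds all letters of u and v:
-- Cross excludes 2143 with N as the 4, and Below excludes 231 with N as the 3.
Cross Below : Word × Word → Set
Cross (u , v) = ∀ {a b c} → b ∷ a ∷ [] ⊆ u → c ∈ v → a < b → b < c → ⊥
Below (u , v) = ∀ {a b} → b ∈ u → a ∈ v → a < b → ⊥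

IsD IsE : Word → Word × Word → Set
IsD zs = Inner λ (u , v) → u ++ v ↭ zs × AvoidC (u ++ v) × Cross (u , v)
IsE zs = Inner λ (u , v) → u ++ v ↭ zs × AvoidC (u ++ v) × Cross (u , v) × Below (u , v)

cross-∷ : Cross (u , v) → (∀ {a c} → a ∈ u → c ∈ v → a < s → s < c → ⊥) → Cross (s ∷ u , v)
cross-∷ cr _ (skip _ p)   = cr p
cross-∷ _  h (refl ∷ p) = h (to∈ p)

cross-[_] : ∀ s → Cross (s ∷ [] , v)
cross-[ s ] (skip _ ())
cross-[ s ] (refl ∷ ())

prependˡ : ℕ → Word × Word → Word × Word
prependˡ s (u , v) = s ∷ u , v

prependˡ-injective : ∀ {x y} → prependˡ s x ≡ prependˡ s y → x ≡ y
prependˡ-injective refl = refl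

splitHead : ∀ {s w zs} → Decreasing zs → s ∷ w ↭ zs →
  ∃₂ λ us vs → zs ≡ us ++ s ∷ vs × w ↭ us ++ vs × All (s <_) us × All (_< s) vs
splitHead {s} ds p with us , vs , refl ← ∈-∃++ (∈-resp-↭ p (here refl)) =
  us , vs , refl , drop-mid [] us p , above us ds , below us ds

cross-min-∷ : All (s <_) (u ++ v) → Cross (u , v) → Cross (s ∷ u , v)
cross-min-∷ s<uv cr = cross-∷ cr λ a∈u _ a<s _ → ℕ.<-asym a<s (All.lookup s<uv (∈-++⁺ˡ a∈u))

cross-max-∷ : ∀ {u v} → All (_< s) (u ++ v) → Cross (u , v) → Cross (s ∷ u , v)
cross-max-∷ {u = u} uv<s cr = cross-∷ cr λ _ c∈v _ s<c → ℕ.<-asym s<c (All.lookup uv<s (∈-++⁺ʳ u c∈v))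

↭-∷⇒∷ʳ : ∀ {m ns} → w ↭ ns → m ∷ w ↭ ns ∷ʳ m
↭-∷⇒∷ʳ {m = m} {ns} p = ↭-trans (↭-prep m p) (∷↭∷ʳ m ns)

↭-nonempty : zs ≢ [] → w ↭ zs → w ≢ []
↭-nonempty zs≢[] p refl = zs≢[] (↭-empty-inv (↭-sym p))

cross-tail : Cross (s ∷ u , v) → Cross (u , v)
cross-tail cr p = cr (skip _ p)

-- The head of `u` must be the least letter. Either it is all of `u`, and `v` is any word of the
-- kind counted by `numC`, or deleting it leaves a smaller split; summing up gives `sumC`.
numE : ℕ → ℕ
numE zero    = 0
numE (suc n) = sumC n

-- Suppose `l` lies below the head `s`. In `v` it violates `Below`. In `u`, any `z` of `v` violates
-- `Cross` if above `s`, and `Below` if below `s`.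
isE-head-min : ∀ {us vs} → v ≢ [] → All (s <_) us → All (_< s) vs → u ++ v ↭ us ++ vs →
  Cross (s ∷ u , v) → Below (s ∷ u , v) → vs ≡ []
isE-head-min {u = u} {us = us} {[]}    _    _    _    _ _  _  = refl
isE-head-min {u = u} {us = us} {l ∷ _} v≢[] s<us (l<s ∷ vs<s) p cr be
  with z , z∈v ← ∈-nonempty v≢[]
  with ∈-++⁻ u (∈-resp-↭ (↭-sym p) (∈-++⁺ʳ us (here refl))) | ∈-++⁻ us (∈-resp-↭ p (∈-++⁺ʳ u z∈v))
... | inj₂ l∈v | _         = ⊥-elim (be (here refl) l∈v l<s)
... | inj₁ l∈u | inj₁ z∈us = ⊥-elim (cr (refl ∷ from∈ l∈u) z∈v l<s (All.lookup s<us z∈us))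
... | inj₁ l∈u | inj₂ z∈vs = ⊥-elim (be (here refl) z∈v (All.lookup (l<s ∷ vs<s) z∈vs))

two-letters : ∀ {u v zs : Word} → u ≢ [] → v ≢ [] → u ++ v ↭ zs → 2 ≤ length zs
two-letters {[]}               u≢[] _    _ = ⊥-elim (u≢[] refl)
two-letters {_ ∷ _} {[]}       _    v≢[] _ = ⊥-elim (v≢[] refl)
two-letters {_ ∷ u} {_ ∷ v} {zs} _    _    p = begin
  2                           ≤⟨ s≤s (s≤s z≤n) ⟩
  suc (suc (length (u ++ v))) ≡⟨ cong suc (length-++-sucʳ u _ v) ⟨
  suc (length (u ++ _ ∷ v))   ≡⟨ ↭-length p ⟩
  length zs                   ∎
  where open ℕ.≤-Reasoning

count-E-∷ʳ : ∀ {zs ns m p q} → zs ≡ ns ∷ʳ m → ns ≢ [] → Decreasing zs →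
  Count (IsE ns) p → Count (IsC ns) q → Count (IsE zs) (p ℕ.+ q)
count-E-∷ʳ {ns = ns} {m} refl ns≢[] ds isE isC = count-⇔
  (λ { (inj₁ ((u , v) , (u≢[] , v≢[] , p , av , cr , be) , refl)) →
         let m<uv = All-resp-↭ (↭-sym p) (above ns ds) in
         (λ ()) , v≢[] , ↭-∷⇒∷ʳ p , avoidC-min-∷ m<uv av , cross-min-∷ m<uv cr ,
         λ { (here refl) a∈v a<m → ℕ.<-asym a<m (All.lookup m<uv (∈-++⁺ʳ u a∈v))
           ; (there b∈u) → be b∈u }
     ; (inj₂ (v , (p , av) , refl)) →
         let m<v = All-resp-↭ (↭-sym p) (above ns ds) in
         (λ ()) , ↭-nonempty ns≢[] p , ↭-∷⇒∷ʳ p , avoidC-min-∷ m<v av , cross-[ m ] ,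
         λ { (here refl) a∈v a<m → ℕ.<-asym a<m (All.lookup m<v a∈v) } })
  (λ { {[] , v} (u≢[] , _) → ⊥-elim (u≢[] refl)
     ; {s ∷ u , v} (_ , v≢[] , p , av , cr , be) → minFirst u v≢[] p av cr be })
  (count-⊎ (count-map (prependˡ m) (λ _ _ → prependˡ-injective) isE)
    (count-map ([ m ] ,_) (λ { _ _ refl → refl }) isC)
    λ { (_ , (u≢[] , _) , eq₁) (_ , _ , refl) → u≢[] (∷-injectiveʳ (sym (cong proj₁ eq₁))) })
  where
  minFirst : ∀ {s v} u → v ≢ [] → s ∷ u ++ v ↭ ns ∷ʳ m →
    AvoidC (s ∷ u ++ v) → Cross (s ∷ u , v) → Below (s ∷ u , v) →
    (∃ λ x → IsE ns x × (s ∷ u , v) ≡ prependˡ m x) ⊎ (∃ λ w → IsC ns w × (s ∷ u , v) ≡ ([ m ] , w))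
  minFirst u v≢[] p av cr be with us , vs , eq , q , s<us , vs<s ← splitHead ds p
    with refl ← isE-head-min {u = u} v≢[] s<us vs<s q cr be
    with refl , refl ← ∷ʳ-injective ns us eq with u
  ... | []    = inj₂ (_ , (subst (_ ↭_) (++-identityʳ us) q , avoidC-⊆ tail-⊆ av) , refl)
  ... | _ ∷ _ = inj₁ (_ ,
    ((λ ()) , v≢[] , subst (_ ↭_) (++-identityʳ us) q , avoidC-⊆ tail-⊆ av , cross-tail cr , be ∘ there) , refl)

snoc-view : ∀ {n} (zs : Word) → length zs ≡ suc n →
            ∃₂ λ (ns : Word) m → zs ≡ ns ∷ʳ m × length ns ≡ n
snoc-view zs eq with initLast zs
... | ns ∷ʳ′ m = ns , m , refl ,
  ℕ.suc-injective (trans (trans (ℕ.+-comm 1 (length ns)) (sym (length-++ ns))) eq)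

length-≢[] : ∀ {n} {ns : Word} → length ns ≡ suc n → ns ≢ []
length-≢[] () refl

count-E : ∀ n zs → length zs ≡ n → Decreasing zs → Count (IsE zs) (numE n)
count-E 0 zs eq ds = count-∅ λ (u≢[] , v≢[] , p , _) →
  ℕ.n≮0 (subst (2 ≤_) eq (two-letters u≢[] v≢[] p))
count-E 1 zs eq ds = count-∅ λ (u≢[] , v≢[] , p , _) →
  ℕ.<-irrefl refl (subst (2 ≤_) eq (two-letters u≢[] v≢[] p))
count-E (suc (suc n)) zs eq ds =
  let ns , m , last , eq′ = snoc-view zs eq
      ds′ = decreasing-prefix ns (subst Decreasing last ds)
  in count-E-∷ʳ last (length-≢[] eq′) ds
    (count-E (suc n) ns eq′ ds′) (subst (λ l → Count (IsC ns) (numC l)) eq′ (count-C ns ds′))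

-- If `u` is a single letter, `Cross` is vacuous and `u ++ v` is any word counted by `numC`.
-- Otherwise the head is the largest or the least letter, and deleting it gives the two equal terms.
numD : ℕ → ℕ
numD 0             = 0
numD 1             = 0
numD (suc (suc n)) = numC (suc (suc n)) ℕ.+ (numD (suc n) ℕ.+ numD (suc n))

-- Suppose letters on both sides of `s` exist, and take `y` in `u` and `z` in `v`. If `s` separates
-- `y` from `z`, the three letters form a 231 or violate `Cross`. If not, a letter on the other side
-- of `s` does the same with `y` or `z`, whichever part it lies in.
isD-head-extreme : ∀ {us vs} → u ≢ [] → v ≢ [] → All (s <_) us → All (_< s) vs → u ++ v ↭ us ++ vs →
  AvoidC (s ∷ u ++ v) → Cross (s ∷ u , v) → us ≡ [] ⊎ vs ≡ []
isD-head-extreme {us = []}                     _ _ _ _ _ _ _ = inj₁ refl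
isD-head-extreme {us = _ ∷ _} {vs = []}      _ _ _ _ _ _ _ = inj₂ refl
isD-head-extreme {u = u} {v} {s} {us = us@(h ∷ _)} {vs = vs@(l ∷ _)} u≢[] v≢[] s<us vs<s p (av231 , _) cr
  with y , y∈u ← ∈-nonempty u≢[] | z , z∈v ← ∈-nonempty v≢[]
  with high∨low (∈-++⁺ˡ y∈u) | high∨low (∈-++⁺ʳ u z∈v)
     | ∈-++⁻ u (∈-resp-↭ (↭-sym p) (here refl)) | ∈-++⁻ u (∈-resp-↭ (↭-sym p) (∈-++⁺ʳ us (here refl)))
  where
  high∨low : ∀ {x} → x ∈ u ++ v → s < x ⊎ x < s
  high∨low x∈ = Sum.map (All.lookup s<us) (All.lookup vs<s) (∈-++⁻ us (∈-resp-↭ p x∈))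
... | inj₁ s<y | inj₂ z<s | _        | _ =
  ⊥-elim (av231 (refl ∷ ++⁺ (from∈ y∈u) (from∈ z∈v)) (mk z<s s<y))
... | inj₁ s<y | inj₁ s<z | _        | inj₁ l∈u =
  ⊥-elim (cr (refl ∷ from∈ l∈u) z∈v (All.head vs<s) s<z)
... | inj₁ s<y | inj₁ s<z | _        | inj₂ l∈v =
  ⊥-elim (av231 (refl ∷ ++⁺ (from∈ y∈u) (from∈ l∈v)) (mk (All.head vs<s) s<y))
... | inj₂ y<s | inj₁ s<z | _        | _ =
  ⊥-elim (cr (refl ∷ from∈ y∈u) z∈v y<s s<z)
... | inj₂ y<s | inj₂ z<s | inj₁ h∈u | _ =
  ⊥-elim (av231 (refl ∷ ++⁺ (from∈ h∈u) (from∈ z∈v)) (mk z<s (All.head s<us)))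
... | inj₂ y<s | inj₂ z<s | inj₂ h∈v | _ =
  ⊥-elim (cr (refl ∷ from∈ y∈u) h∈v y<s (All.head s<us))

isolateHead : Word → Word × Word
isolateHead []      = [] , []
isolateHead (s ∷ v) = [ s ] , v

isolateHead-injective : u ≢ [] → v ≢ [] → isolateHead u ≡ isolateHead v → u ≡ v
isolateHead-injective {[]}    u≢[] _ _ = ⊥-elim (u≢[] refl)
isolateHead-injective {_ ∷ _} {[]}    _ v≢[] _ = ⊥-elim (v≢[] refl)
isolateHead-injective {_ ∷ _} {_ ∷ _} _ _ refl = refl

¬isolated : ∀ {x} → proj₁ x ≢ [] → prependˡ s x ≢ isolateHead w
¬isolated {w = _ ∷ _} u≢[] eq = u≢[] (∷-injectiveʳ (cong proj₁ eq))

count-D-step : ∀ {zs M ms ns m p q r} → zs ≡ M ∷ ms → zs ≡ ns ∷ʳ m → ms ≢ [] → M ≢ m → Decreasing zs →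
  Count (IsC zs) p → Count (IsD ms) q → Count (IsD ns) r → Count (IsD zs) (p ℕ.+ (q ℕ.+ r))
count-D-step {zs} {M} {ms} {ns} {m} first last ms≢[] M≢m ds isC isDms isDns = count-⇔
  (λ { (inj₁ ([] , (p , _) , refl)) → ⊥-elim (↭-nonempty zs≢[] p refl)
     ; (inj₁ (s ∷ v , (p , av) , refl)) →
         (λ ()) , (λ { refl → ms≢[] (short (subst (_ ↭_) first p)) }) , p , av , cross-[ s ]
     ; (inj₂ (inj₁ ((u , v) , (_ , v≢[] , p , av , cr) , refl))) →
         let uv<M = All-resp-↭ (↭-sym p) ms<M in
         (λ ()) , v≢[] , subst (_ ↭_) (sym first) (↭-prep M p) ,
         avoidC-max-∷ uv<M av , cross-max-∷ {u = u} uv<M cr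
     ; (inj₂ (inj₂ ((u , v) , (_ , v≢[] , p , av , cr) , refl))) →
         let m<uv = All-resp-↭ (↭-sym p) m<ns in
         (λ ()) , v≢[] , subst (_ ↭_) (sym last) (↭-∷⇒∷ʳ p) ,
         avoidC-min-∷ m<uv av , cross-min-∷ m<uv cr })
  (λ { {[] , _} (u≢[] , _) → ⊥-elim (u≢[] refl)
     ; {s ∷ [] , v} (_ , _ , p , av , _) → inj₁ (s ∷ v , (p , av) , refl)
     ; {s ∷ u@(_ ∷ _) , v} (_ , v≢[] , p , av , cr) → inj₂ (extreme u (λ ()) v≢[] p av cr) })
  (count-⊎
    (count-map isolateHead
      (λ (p , _) (q , _) → isolateHead-injective (↭-nonempty zs≢[] p) (↭-nonempty zs≢[] q)) isC)
    (count-⊎ (count-map (prependˡ M) (λ _ _ → prependˡ-injective) isDms)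
      (count-map (prependˡ m) (λ _ _ → prependˡ-injective) isDns)
      λ { (_ , _ , refl) (_ , _ , eq) → M≢m (∷-injectiveˡ (cong proj₁ eq)) })
    λ { (_ , _ , eq) (inj₁ (_ , (u≢[] , _) , refl)) → ¬isolated u≢[] eq
      ; (_ , _ , eq) (inj₂ (_ , (u≢[] , _) , refl)) → ¬isolated u≢[] eq })
  where
  zs≢[] : zs ≢ []
  zs≢[] eq with () ← trans (sym eq) first
  ms<M : All (_< M) ms
  ms<M = AllPairs.head (subst Decreasing first ds)
  m<ns : All (m <_) ns
  m<ns = above ns (subst Decreasing last ds)
  short : ∀ {s} → s ∷ [] ↭ M ∷ ms → ms ≡ []
  short p = ∷-injectiveʳ (↭-singleton-inv (↭-sym p))
  extreme : ∀ {s v} u → u ≢ [] → v ≢ [] → s ∷ u ++ v ↭ zs → AvoidC (s ∷ u ++ v) → Cross (s ∷ u , v) →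
    (∃ λ x → IsD ms x × (s ∷ u , v) ≡ prependˡ M x) ⊎ (∃ λ x → IsD ns x × (s ∷ u , v) ≡ prependˡ m x)
  extreme u u≢[] v≢[] p av cr with us , vs , eq , q , s<us , vs<s ← splitHead ds p
    with isD-head-extreme {u = u} u≢[] v≢[] s<us vs<s q av cr
  ... | inj₁ refl with refl ← trans (sym first) eq =
    inj₁ (_ , (u≢[] , v≢[] , q , avoidC-⊆ tail-⊆ av , cross-tail cr) , refl)
  ... | inj₂ refl with refl , refl ← ∷ʳ-injective ns us (trans (sym last) eq) =
    inj₂ (_ , (u≢[] , v≢[] , subst (_ ↭_) (++-identityʳ us) q ,
      avoidC-⊆ tail-⊆ av , cross-tail cr) , refl)

count-D : ∀ n zs → length zs ≡ n → Decreasing zs → Count (IsD zs) (numD n)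
count-D 0 zs eq ds = count-∅ λ (u≢[] , v≢[] , p , _) →
  ℕ.n≮0 (subst (2 ≤_) eq (two-letters u≢[] v≢[] p))
count-D 1 zs eq ds = count-∅ λ (u≢[] , v≢[] , p , _) →
  ℕ.<-irrefl refl (subst (2 ≤_) eq (two-letters u≢[] v≢[] p))
count-D (suc (suc n)) zs@(M ∷ ms) eq ds@(ms<M ∷ ds″) =
  let ns , m , last , eq′ = snoc-view zs eq
      ds′ = decreasing-prefix ns (subst Decreasing last ds)
  in count-D-step refl last (length-≢[] (ℕ.suc-injective eq)) (distinct ns last eq′) ds
    (subst (λ l → Count (IsC zs) (numC l)) eq (count-C zs ds))
    (count-D (suc n) ms (ℕ.suc-injective eq) ds″)
    (count-D (suc n) ns eq′ ds′)
  where
  distinct : ∀ ns {m} → M ∷ ms ≡ ns ∷ʳ m → length ns ≡ suc n → M ≢ m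
  distinct (_ ∷ ns) eq _ refl = max∉ ms<M (subst (M ∈_) (sym (∷-injectiveʳ eq)) (∈-∷ʳ ns))

-- Words avoiding T

-- Only `s` precedes `N`, while 2143 and 2341 need two letters before their 4; hence `N` can only
-- open a 4231.
avoidT-∷-max-∷ : ∀ {w} → s < N → All (_< N) w → AvoidT (s ∷ w) → Avoid P231 w → AvoidT (s ∷ N ∷ w)
avoidT-∷-max-∷ {s} {N} {w} s<N w<N (a , b , c) av231 =
  avoid2143-insert-max (s<N ∷ []) w<N a (λ p → ⊥-elim (¬pair p)) ,
  avoid2341-insert-max (s<N ∷ []) w<N b (λ p → ⊥-elim (¬pair p)) ,
  avoid4231-insert-max (s<N ∷ []) w<N c av231
  where
  ¬pair : ∀ {x y} → ¬ (x ∷ y ∷ [] ⊆ [ s ])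
  ¬pair (skip _ ())
  ¬pair (refl ∷ ())

avoidT-∷-max-∷⁻ : ∀ {w} → All (_< N) w → AvoidT (s ∷ N ∷ w) → AvoidT (s ∷ w) × Avoid P231 w
avoidT-∷-max-∷⁻ {s = s} w<N av@(_ , _ , av4231) = avoidT-⊆ (delete-⊆ [ s ]) av ,
  λ { p (mk a<b b<c) → av4231 (skip s (refl ∷ p)) (mk a<b b<c (All.lookup w<N (to∈ (⊆-trans tail-⊆ p)))) }

-- Let `l` be a low letter in `v`. A high letter in `u` would give the 2341 formed by `s`, that
-- letter, `N` and `l`. So `u` has a low letter `y` and some high `h` is in `v`, and `s`, `y`, `N`,
-- `h` form a 2143.
avoidT-max-low∉ : ∀ {us vs} → us ≢ [] → All (s <_) us → All (_< s) vs → All (_< N) us →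
  u ≢ [] → u ++ v ↭ us ++ vs → AvoidT (s ∷ u ++ N ∷ v) → ∀ {l} → l ∈ vs → l ∉ v
avoidT-max-low∉ {u = u} {v} {us} us≢[] s<us vs<s us<N u≢[] p (av2143 , av2341 , _) l∈vs l∈v
  with y , y∈u ← ∈-nonempty u≢[] | h , h∈us ← ∈-nonempty us≢[]
  with ∈-++⁻ us (∈-resp-↭ p (∈-++⁺ˡ y∈u)) | ∈-++⁻ u (∈-resp-↭ (↭-sym p) (∈-++⁺ˡ h∈us))
... | inj₁ y∈us | _        = av2341 (refl ∷ ∈-insert-∈ y∈u l∈v)
  (mk (All.lookup vs<s l∈vs) (All.lookup s<us y∈us) (All.lookup us<N y∈us))
... | inj₂ y∈vs | inj₁ h∈u = av2341 (refl ∷ ∈-insert-∈ h∈u l∈v)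
  (mk (All.lookup vs<s l∈vs) (All.lookup s<us h∈us) (All.lookup us<N h∈us))
... | inj₂ y∈vs | inj₂ h∈v = av2143 (refl ∷ ∈-insert-∈ y∈u h∈v)
  (mk (All.lookup vs<s y∈vs) (All.lookup s<us h∈us) (All.lookup us<N h∈us))

-- With lower letters and a second higher letter present, the maximum N comes first or last.
avoidT-max-extreme : ∀ {us vs} → us ≢ [] → vs ≢ [] → All (s <_) us → All (_< s) vs → All (_< N) us →
  u ≢ [] → v ≢ [] → u ++ v ↭ us ++ vs → ¬ AvoidT (s ∷ u ++ N ∷ v)
avoidT-max-extreme {u = u} {us = us} us≢[] vs≢[] s<us vs<s us<N u≢[] v≢[] p av
  with z , z∈v ← ∈-nonempty v≢[] | l , l∈vs ← ∈-nonempty vs≢[]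
  with ∈-++⁻ us (∈-resp-↭ p (∈-++⁺ʳ u z∈v)) | ∈-++⁻ u (∈-resp-↭ (↭-sym p) (∈-++⁺ʳ us l∈vs))
... | inj₂ z∈vs | _        = avoidT-max-low∉ us≢[] s<us vs<s us<N u≢[] p av z∈vs z∈v
... | inj₁ _    | inj₂ l∈v = avoidT-max-low∉ us≢[] s<us vs<s us<N u≢[] p av l∈vs l∈v
... | inj₁ z∈us | inj₁ l∈u = proj₁ av (refl ∷ ∈-insert-∈ l∈u z∈v)
  (mk (All.lookup vs<s l∈vs) (All.lookup s<us z∈us) (All.lookup us<N z∈us))

-- Here `N` is the only letter above `s`. Both a 2341 and a 4231 through `N` leave a 231 in
-- `u ++ v`, so `Cross` is the only new condition.
avoidT-max-inner : ∀ {u v} → All (_< s) (u ++ v) → s < N →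
  AvoidC (u ++ v) → Cross (u , v) → AvoidT (s ∷ u ++ N ∷ v)
avoidT-max-inner {s} {N} {u} {v} uv<s s<N avC cr =
  avoid2143-insert-max su<N v<N a (λ { (skip _ p) c∈v a<b b<c → cr p c∈v a<b b<c
                                     ; (refl ∷ _) c∈v _ s<c → ℕ.<-asym s<c (All.lookup v<s c∈v) }) ,
  avoid2341-insert-max su<N v<N b (λ { (skip _ p) a∈v a<b b<c → proj₁ avC (++⁺ p (from∈ a∈v)) (mk a<b b<c)
                                     ; (refl ∷ p) _ _ s<c → ℕ.<-asym s<c (All.lookup u<s (to∈ p)) }) ,
  avoid4231-insert-max su<N v<N c (avoid-⊆ (++⁺ˡ u ⊆-refl) (proj₁ avC))
  where
  u<s = All.++⁻ˡ u uv<s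
  v<s = All.++⁻ʳ u uv<s
  v<N = All.map (λ x<s → ℕ.<-trans x<s s<N) v<s
  su<N : All (_< N) (s ∷ u)
  su<N = s<N ∷ All.map (λ x<s → ℕ.<-trans x<s s<N) u<s
  avT = avoidT-max-∷ uv<s avC
  a = proj₁ avT
  b = proj₁ (proj₂ avT)
  c = proj₂ (proj₂ avT)

avoidT-max-inner⁻ : ∀ {u v} → All (_< s) (u ++ v) → s < N →
  AvoidT (s ∷ u ++ N ∷ v) → AvoidC (u ++ v) × Cross (u , v)
avoidT-max-inner⁻ {s} {u = u} uv<s s<N av@(av2143 , _) =
  avoidT-max-∷⁻ uv<s (avoidT-⊆ (refl ∷ delete-⊆ u) av) ,
  λ p c∈v a<b b<c → av2143 (skip s (++⁺ p (refl ∷ from∈ c∈v)))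
    (mk a<b b<c (ℕ.<-trans (All.lookup uv<s (∈-++⁺ʳ u c∈v)) s<N))

inner : ℕ → ℕ → ℕ
inner r zero    = r
inner r (suc _) = 0

-- The summands are the front, back and middle positions of the largest of the
-- k + 1 higher letters; the middle is possible only for k = 0.
numX numX′ : ℕ → ℕ → ℕ
numX′ j zero    = numC j
numX′ j (suc k) = numX′ j k ℕ.+ (numX′ j k ℕ.+ inner (numE j) k)
numX  j zero    = numC j
numX  j (suc k) = numX′ j k ℕ.+ (numX j k ℕ.+ inner (numD j) k)

-- Tails of T-avoiding words starting with s; those in IsX′ may moreover be
-- preceded by a new largest letter (avoidT-∷-max-∷).
IsX IsX′ : ℕ → Word → Word → Set
IsX  s zs w = w ↭ zs × AvoidT (s ∷ w)
IsX′ s zs w = w ↭ zs × AvoidT (s ∷ w) × Avoid P231 w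

module _ {us : Word} {s : ℕ} {vs : Word} {N : ℕ} (vs≢[] : vs ≢ []) (zs<N : All (_< N) (us ++ s ∷ vs)) where
  private
    s<N : s < N
    s<N = All.head (All.++⁻ʳ us zs<N)
    w<N : w ↭ us ++ vs → All (_< N) w
    w<N p = All-resp-↭ (↭-sym p) (delete-All us zs<N)

  -- The rest already avoids 231, which is the price of putting `N` first; so both ends accept the
  -- same words.
  count-X′-step : ∀ {k r} → Count (IsX′ s (us ++ vs)) k →
    Count (Inner λ (u , v) → u ++ v ↭ us ++ vs × AvoidT (s ∷ u ++ N ∷ v) × Avoid P231 (u ++ N ∷ v)) r →
    Count (IsX′ s (N ∷ us ++ vs)) (k ℕ.+ (k ℕ.+ r))
  count-X′-step isX′ isInner = count-byLetter (us ++ vs) N (++-≢[] us vs≢[]) (max∉ (w<N ↭-refl))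
    (count-⇔ {P = IsX′ s (us ++ vs)}
      (λ (p , av , av231) → p , avoidT-∷-max-∷ s<N (w<N p) av av231 ,
        avoid231-insert-max [] (w<N p) av231 λ ())
      (λ (p , av , _) → p , avoidT-∷-max-∷⁻ (w<N p) av) isX′)
    (count-⇔ {P = IsX′ s (us ++ vs)}
      (λ (p , av , av231) → p , avoidT-∷ʳ-max (s<N ∷ w<N p) av , avoid231-∷ʳ-max (w<N p) av231)
      (λ { {w} (p , av , av231) → p , avoidT-⊆ (init-⊆ (s ∷ w)) av , avoid-⊆ (init-⊆ w) av231 }) isX′)
    isInner

  count-X-step : ∀ {k l r} → Count (IsX′ s (us ++ vs)) k → Count (IsX s (us ++ vs)) l →
    Count (Inner λ (u , v) → u ++ v ↭ us ++ vs × AvoidT (s ∷ u ++ N ∷ v)) r →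
    Count (IsX s (N ∷ us ++ vs)) (k ℕ.+ (l ℕ.+ r))
  count-X-step isX′ isX isInner = count-byLetter (us ++ vs) N (++-≢[] us vs≢[]) (max∉ (w<N ↭-refl))
    (count-⇔
      (λ (p , av , av231) → p , avoidT-∷-max-∷ s<N (w<N p) av av231)
      (λ (p , av) → p , avoidT-∷-max-∷⁻ (w<N p) av) isX′)
    (count-⇔
      (λ (p , av) → p , avoidT-∷ʳ-max (s<N ∷ w<N p) av)
      (λ (p , av) → p , avoidT-⊆ (init-⊆ _) av) isX)
    isInner

module _ {s : ℕ} {vs : Word} {N : ℕ} (vs<s : All (_< s) vs) (s<N : s < N) where
  private
    uv<s : w ↭ vs → All (_< s) w
    uv<s p = All-resp-↭ (↭-sym p) vs<s
    <N : All (_< s) w → All (_< N) w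
    <N = All.map λ x<s → ℕ.<-trans x<s s<N

  count-inner-D : ∀ {n} → Count (IsD vs) n →
    Count (Inner λ (u , v) → u ++ v ↭ vs × AvoidT (s ∷ u ++ N ∷ v)) n
  count-inner-D = count-⇔
    (λ (u≢[] , v≢[] , p , av , cr) → u≢[] , v≢[] , p , avoidT-max-inner (uv<s p) s<N av cr)
    (λ (u≢[] , v≢[] , p , av) → u≢[] , v≢[] , p , avoidT-max-inner⁻ (uv<s p) s<N av)

  count-inner-E : ∀ {n} → Count (IsE vs) n →
    Count (Inner λ (u , v) → u ++ v ↭ vs × AvoidT (s ∷ u ++ N ∷ v) × Avoid P231 (u ++ N ∷ v)) n
  count-inner-E = count-⇔
    (λ { {u , v} (u≢[] , v≢[] , p , av , cr , be) → u≢[] , v≢[] , p , avoidT-max-inner (uv<s p) s<N av cr ,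
         avoid231-insert-max (<N (All.++⁻ˡ u (uv<s p))) (<N (All.++⁻ʳ u (uv<s p))) (proj₁ av) be })
    (λ { {u , v} (u≢[] , v≢[] , p , av , av231) →
         let avC , cr = avoidT-max-inner⁻ (uv<s p) s<N av in
         u≢[] , v≢[] , p , avC , cr , λ b∈u a∈v a<b →
           av231 (∈-insert-∈ b∈u a∈v) (mk a<b (All.lookup (<N (uv<s p)) (∈-++⁺ˡ b∈u))) })

module _ (s : ℕ) (vs : Word) (vs≢[] : vs ≢ []) where
  private
    ¬inner : ∀ {N N′ us} → Decreasing (N ∷ N′ ∷ us ++ s ∷ vs) →
      u ≢ [] → v ≢ [] → u ++ v ↭ N′ ∷ us ++ vs → ¬ AvoidT (s ∷ u ++ N ∷ v)
    ¬inner {N = N} {N′} {us} (zs<N ∷ ds) = avoidT-max-extreme (λ ()) vs≢[]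
      (above (N′ ∷ us) ds) (below (N′ ∷ us) ds) (All.++⁻ˡ (N′ ∷ us) zs<N)

  count-X′ : ∀ us → Decreasing (us ++ s ∷ vs) → Count (IsX′ s (us ++ vs)) (numX′ (length vs) (length us))
  count-X′ [] (vs<s ∷ ds) = count-⇔
    (λ (p , av) → p , avoidT-max-∷ (All-resp-↭ (↭-sym p) vs<s) av , proj₁ av)
    (λ (p , av , _) → p , avoidT-max-∷⁻ (All-resp-↭ (↭-sym p) vs<s) av)
    (count-C vs ds)
  count-X′ (N ∷ []) (zs<N ∷ vs<s ∷ ds) = count-X′-step {us = []} vs≢[] zs<N (count-X′ [] (vs<s ∷ ds))
    (count-inner-E vs<s (All.head zs<N) (count-E _ vs refl ds))
  count-X′ (N ∷ us@(_ ∷ _)) ds@(zs<N ∷ ds′) = count-X′-step {us = us} vs≢[] zs<N (count-X′ us ds′)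
    (count-∅ λ (u≢[] , v≢[] , p , av , _) → ¬inner ds u≢[] v≢[] p av)

  count-X : ∀ us → Decreasing (us ++ s ∷ vs) → Count (IsX s (us ++ vs)) (numX (length vs) (length us))
  count-X [] (vs<s ∷ ds) = count-⇔
    (λ (p , av) → p , avoidT-max-∷ (All-resp-↭ (↭-sym p) vs<s) av)
    (λ (p , av) → p , avoidT-max-∷⁻ (All-resp-↭ (↭-sym p) vs<s) av)
    (count-C vs ds)
  count-X (N ∷ []) (zs<N ∷ vs<s ∷ ds) = count-X-step {us = []} vs≢[] zs<N
    (count-X′ [] (vs<s ∷ ds)) (count-X [] (vs<s ∷ ds))
    (count-inner-D vs<s (All.head zs<N) (count-D _ vs refl ds))
  count-X (N ∷ us@(_ ∷ _)) ds@(zs<N ∷ ds′) = count-X-step {us = us} vs≢[] zs<N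
    (count-X′ us ds′) (count-X us ds′)
    (count-∅ λ (u≢[] , v≢[] , p , av) → ¬inner ds u≢[] v≢[] p av)

-- An antidiagonal sum with at least one lower letter: `sumX numX 0 n` counts the `T`-avoiding words
-- on n + 1 letters whose head is not the least.
sumX : (ℕ → ℕ → ℕ) → ℕ → ℕ → ℕ
sumX f i zero    = 0
sumX f i (suc j) = f (suc j) i ℕ.+ sumX f (suc i) j

numT : ℕ → ℕ
numT zero    = 1
numT (suc n) = numT n ℕ.+ sumX numX 0 n

tByHead : ℕ → ℕ → ℕ
tByHead i zero    = numT i
tByHead i (suc j) = numX (suc j) i

sum-tByHead : ∀ i j → sumSplits tByHead i (suc j) ≡ numT (i ℕ.+ j) ℕ.+ sumX numX i j
sum-tByHead i zero    = cong (λ k → numT k ℕ.+ 0) (sym (ℕ.+-identityʳ i))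
sum-tByHead i (suc j) = begin
  numX (suc j) i ℕ.+ sumSplits tByHead (suc i) (suc j)
    ≡⟨ cong (numX (suc j) i ℕ.+_) (sum-tByHead (suc i) j) ⟩
  numX (suc j) i ℕ.+ (numT (suc i ℕ.+ j) ℕ.+ sumX numX (suc i) j)
    ≡⟨ regroup (numX (suc j) i) (numT (suc i ℕ.+ j)) (sumX numX (suc i) j) ⟩
  numT (suc i ℕ.+ j) ℕ.+ sumX numX i (suc j)
    ≡⟨ cong (λ k → numT k ℕ.+ sumX numX i (suc j)) (ℕ.+-suc i j) ⟨
  numT (i ℕ.+ suc j) ℕ.+ sumX numX i (suc j) ∎
  where
  open ≡-Reasoning
  regroup : ∀ k l m → k ℕ.+ (l ℕ.+ m) ≡ l ℕ.+ (k ℕ.+ m)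
  regroup = ℕ.solve-∀

IsT : Word → Word → Set
IsT zs w = w ↭ zs × AvoidT w

count-T : ∀ zs → Decreasing zs → Count (IsT zs) (numT (length zs))
count-T zs = go (length zs) zs ℕ.≤-refl
  where
  go : ∀ k zs → length zs ≤ k → Decreasing zs → Count (IsT zs) (numT (length zs))
  go _       []            _  _  = count-[]↭ avoidT-[]
  go (suc k) zs@(_ ∷ zs′) le ds = subst (Count (IsT zs)) (sum-tByHead 0 (length zs′))
    (count-byHead {f = tByHead} zs (λ ()) (decreasing-unique ds) byHead)
    where
    byHead : ∀ us s vs → zs ≡ us ++ s ∷ vs →
             Count (λ w → w ↭ us ++ vs × AvoidT (s ∷ w)) (tByHead (length us) (length vs))
    byHead us s [] eq = count-⇔
      (λ (p , av) → subst (_ ↭_) (sym (++-identityʳ us)) p ,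
        avoidT-min-∷ (All-resp-↭ (↭-sym p) (above us ds′)) av)
      (λ (p , av) → subst (_ ↭_) (++-identityʳ us) p , avoidT-⊆ tail-⊆ av)
      (go k us (length-prefix us (subst (λ z → length z ≤ suc k) eq le)) (decreasing-prefix us ds′))
      where ds′ = subst Decreasing eq ds
    byHead us s vs@(_ ∷ _) eq = count-X s vs (λ ()) us (subst Decreasing eq ds)

-- The linear recurrence

-- Of the whole antidiagonal only the term at `i` = 0 receives a contribution of `inner`. For `j` =
-- 0 there is no such term, hence the condition on `r 0`.
sumX-step : ∀ {f p q : ℕ → ℕ → ℕ} {r : ℕ → ℕ} → r 0 ≡ 0 →
  (∀ j i → f j (suc i) ≡ p j i ℕ.+ (q j i ℕ.+ inner (r j) i)) →
  ∀ i j → sumX f (suc i) j ≡ sumX p i j ℕ.+ (sumX q i j ℕ.+ inner (r j) i)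
sumX-step r₀ step zero    zero    = sym r₀
sumX-step r₀ step (suc i) zero    = refl
sumX-step {f} {p} {q} {r} r₀ step i (suc j) = begin
  f (suc j) (suc i) ℕ.+ sumX f (suc (suc i)) j
    ≡⟨ cong₂ ℕ._+_ (step (suc j) i) (sumX-step {f} {p} {q} {r} r₀ step (suc i) j) ⟩
  p (suc j) i ℕ.+ (q (suc j) i ℕ.+ inner (r (suc j)) i) ℕ.+ (sumX p (suc i) j ℕ.+ (sumX q (suc i) j ℕ.+ 0))
    ≡⟨ regroup (p (suc j) i) (q (suc j) i) (inner (r (suc j)) i) (sumX p (suc i) j) (sumX q (suc i) j) ⟩
  p (suc j) i ℕ.+ sumX p (suc i) j ℕ.+ (q (suc j) i ℕ.+ sumX q (suc i) j ℕ.+ inner (r (suc j)) i) ∎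
  where
  open ≡-Reasoning
  regroup : ∀ k l m k′ l′ → k ℕ.+ (l ℕ.+ m) ℕ.+ (k′ ℕ.+ (l′ ℕ.+ 0)) ≡ k ℕ.+ k′ ℕ.+ (l ℕ.+ l′ ℕ.+ m)
  regroup = ℕ.solve-∀

record State : Set where
  constructor state
  field t ΣX ΣX′ c d e : ℕ

next : State → State
next (state t ΣX ΣX′ c d e) = state
  (t ℕ.+ ΣX) (c′ ℕ.+ (ΣX′ ℕ.+ (ΣX ℕ.+ d))) (c′ ℕ.+ (ΣX′ ℕ.+ (ΣX′ ℕ.+ e))) c′ (c′ ℕ.+ (d ℕ.+ d)) (e ℕ.+ c)
  where c′ = c ℕ.+ (e ℕ.+ c)

stateAt : ℕ → State
stateAt n = state (numT n) (sumX numX 0 n) (sumX numX′ 0 n) (numC n) (numD n) (numE n)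

-- The step uses sumC n = numE n + numC n, which fails at n = 0.
stateAt-suc : ∀ n → stateAt (suc (suc n)) ≡ next (stateAt (suc n))
stateAt-suc n = cong₂
  (λ ΣX ΣX′ → let n″ = suc (suc n) in state (numT n″) ΣX ΣX′ (numC n″) (numD n″) (numE n″))
  (cong (numC (suc (suc n)) ℕ.+_) (sumX-step {numX} {numX′} {numX} {numD} refl (λ _ _ → refl) 0 (suc n)))
  (cong (numC (suc (suc n)) ℕ.+_) (sumX-step {numX′} {numX′} {numX′} {numE} refl (λ _ _ → refl) 0 (suc n)))

-- The shape to which (f * denominator) 5 evaluates.
Recurrence : (ℕ → ℕ) → Set
Recurrence f = + f 0 ℤ.* -[1+ 1 ] ℤ.+ (+ f 1 ℤ.* + 11 ℤ.+ (+ f 2 ℤ.* -[1+ 20 ] ℤ.+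
               (+ f 3 ℤ.* + 18 ℤ.+ (+ f 4 ℤ.* -[1+ 6 ] ℤ.+ (+ f 5 ℤ.* 1ℤ ℤ.+ 0ℤ))))) ≡ 0ℤ

iterate : ℕ → State → State
iterate zero    s = s
iterate (suc k) s = iterate k (next s)

iterate-stateAt : ∀ k n → stateAt (k ℕ.+ suc n) ≡ iterate k (stateAt (suc n))
iterate-stateAt zero    n = refl
iterate-stateAt (suc k) n = trans (cong stateAt (sym (ℕ.+-suc k (suc n))))
  (trans (iterate-stateAt k (suc n)) (cong (iterate k) (stateAt-suc n)))

-- `next` is linear and block triangular: `c` and `e` form a block with characteristic polynomial λ²
-- - 3λ + 1, `d` and `ΣX′` double independently, `ΣX` and `t` have eigenvalue 1. As the eigenvalue 2
-- carries no Jordan block, (λ - 1)²(λ - 2)(λ² - 3λ + 1), of degree 5, annihilates this map on six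
-- coordinates from any state. Its coefficients, constant term first, are those of `Recurrence`.
recurrence-iterate : ∀ s → Recurrence (λ k → State.t (iterate k s))
recurrence-iterate (state t ΣX ΣX′ c d e) = lemma (+ t) (+ ΣX) (+ ΣX′) (+ c) (+ d) (+ e)
  where
  open import Data.Integer.Base using (_+_; _*_)
  lemma : ∀ T X X′ C D E →
    let C₁ = C + (E + C) ; E₁ = E + C ; D₁ = C₁ + (D + D)
        X₁ = C₁ + (X′ + (X + D)) ; X′₁ = C₁ + (X′ + (X′ + E))
        C₂ = C₁ + (E₁ + C₁) ; E₂ = E₁ + C₁ ; D₂ = C₂ + (D₁ + D₁)
        X₂ = C₂ + (X′₁ + (X₁ + D₁)) ; X′₂ = C₂ + (X′₁ + (X′₁ + E₁))
        C₃ = C₂ + (E₂ + C₂) ; E₃ = E₂ + C₂ ; D₃ = C₃ + (D₂ + D₂)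
        X₃ = C₃ + (X′₂ + (X₂ + D₂)) ; X′₃ = C₃ + (X′₂ + (X′₂ + E₂))
        C₄ = C₃ + (E₃ + C₃) ; X₄ = C₄ + (X′₃ + (X₃ + D₃))
        T₁ = T + X ; T₂ = T₁ + X₁ ; T₃ = T₂ + X₂ ; T₄ = T₃ + X₃ ; T₅ = T₄ + X₄
    in T * -[1+ 1 ] + (T₁ * + 11 + (T₂ * -[1+ 20 ] + (T₃ * + 18 + (T₄ * -[1+ 6 ] + (T₅ * 1ℤ + 0ℤ))))) ≡ 0ℤ
  lemma = ℤ.solve-∀

recurrence-cong : ∀ {f g : ℕ → ℕ} → f ≗ g → Recurrence f → Recurrence g
recurrence-cong f≗g rec
  rewrite sym (f≗g 0) | sym (f≗g 1) | sym (f≗g 2) | sym (f≗g 3) | sym (f≗g 4) | sym (f≗g 5) = rec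

numT-recurrence : ∀ n → Recurrence λ k → numT (n ℕ.+ k)
-- `stateAt 1` is not `next (stateAt 0)`, so the window starting at 0 is checked on its six values.
numT-recurrence zero    = refl
numT-recurrence (suc n) = recurrence-cong
  (λ k → trans (sym (cong State.t (iterate-stateAt k n))) (cong numT (ℕ.+-comm k (suc n))))
  (recurrence-iterate (stateAt (suc n)))

-- The words counted by F T

SameOrder : (x y a b : ℕ) → Set
SameOrder x y a b = (x < a ⇔ y < b) × (a < x ⇔ b < y)

up : ∀ {x y a b} → x < a → y < b → SameOrder x y a b
up x<a y<b = mk⇔ (λ _ → y<b) (λ _ → x<a) ,
             mk⇔ (contradiction x<a ∘ ℕ.<-asym) (contradiction y<b ∘ ℕ.<-asym)

down : ∀ {x y a b} → a < x → b < y → SameOrder x y a b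
down a<x b<y = let p , q = up a<x b<y in q , p

orderIsomorphic-∷ : ∀ {x y σ τ} → Pointwise (SameOrder x y) σ τ →
                    OrderIsomorphic σ τ → OrderIsomorphic (x ∷ σ) (y ∷ τ)
orderIsomorphic-∷ {x} {y} {σ} {τ} rs (eq , iso) = cong suc eq , λ where
  zero    zero    → mk⇔ (λ x<x → contradiction x<x (ℕ.<-irrefl refl))
                        (λ y<y → contradiction y<y (ℕ.<-irrefl refl))
  zero    (suc j) → proj₁ (Pointwise.lookup⁺ rs j)
  (suc i) zero    → proj₂ (Pointwise.lookup⁺ rs i)
  (suc i) (suc j) → iso i j

orderIsomorphic-[] : OrderIsomorphic [] []
orderIsomorphic-[] = refl , λ ()

private
  lt : ∀ {m n} {m<n : True (m ℕ.<? n)} → m < n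
  lt {m<n = m<n} = toWitness m<n

P2143⇒orderIsomorphic : ∀ {σ} → P2143 σ → OrderIsomorphic σ (2 ∷ 1 ∷ 4 ∷ 3 ∷ [])
P2143⇒orderIsomorphic (mk a<b b<c c<d) =
    orderIsomorphic-∷ (down a<b lt ∷ up (ℕ.<-trans b<c c<d) lt ∷ up b<c lt ∷ [])
    (orderIsomorphic-∷ (up (ℕ.<-trans a<b (ℕ.<-trans b<c c<d)) lt ∷ up (ℕ.<-trans a<b b<c) lt ∷ [])
    (orderIsomorphic-∷ (down c<d lt ∷ [])
    (orderIsomorphic-∷ [] orderIsomorphic-[])))

orderIsomorphic⇒P2143 : ∀ {σ} → OrderIsomorphic σ (2 ∷ 1 ∷ 4 ∷ 3 ∷ []) → P2143 σ
orderIsomorphic⇒P2143 {_ ∷ _ ∷ _ ∷ _ ∷ []} (refl , iso) =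
  -- The index pairs are the positions of the values 1 and 2, 2 and 3, 3 and 4 in the pattern;
  -- likewise for the other two patterns.
  mk (Equivalence.from (iso 1F 0F) lt)
     (Equivalence.from (iso 0F 3F) lt)
     (Equivalence.from (iso 3F 2F) lt)

P2341⇒orderIsomorphic : ∀ {σ} → P2341 σ → OrderIsomorphic σ (2 ∷ 3 ∷ 4 ∷ 1 ∷ [])
P2341⇒orderIsomorphic (mk a<b b<c c<d) =
    orderIsomorphic-∷ (up b<c lt ∷ up (ℕ.<-trans b<c c<d) lt ∷ down a<b lt ∷ [])
    (orderIsomorphic-∷ (up c<d lt ∷ down (ℕ.<-trans a<b b<c) lt ∷ [])
    (orderIsomorphic-∷ (down (ℕ.<-trans a<b (ℕ.<-trans b<c c<d)) lt ∷ [])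
    (orderIsomorphic-∷ [] orderIsomorphic-[])))

orderIsomorphic⇒P2341 : ∀ {σ} → OrderIsomorphic σ (2 ∷ 3 ∷ 4 ∷ 1 ∷ []) → P2341 σ
orderIsomorphic⇒P2341 {_ ∷ _ ∷ _ ∷ _ ∷ []} (refl , iso) =
  mk (Equivalence.from (iso 3F 0F) lt)
     (Equivalence.from (iso 0F 1F) lt)
     (Equivalence.from (iso 1F 2F) lt)

P4231⇒orderIsomorphic : ∀ {σ} → P4231 σ → OrderIsomorphic σ (4 ∷ 2 ∷ 3 ∷ 1 ∷ [])
P4231⇒orderIsomorphic (mk a<b b<c c<d) =
    orderIsomorphic-∷
      (down (ℕ.<-trans b<c c<d) lt ∷ down c<d lt ∷ down (ℕ.<-trans a<b (ℕ.<-trans b<c c<d)) lt ∷ [])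
    (orderIsomorphic-∷ (up b<c lt ∷ down a<b lt ∷ [])
    (orderIsomorphic-∷ (down (ℕ.<-trans a<b b<c) lt ∷ [])
    (orderIsomorphic-∷ [] orderIsomorphic-[])))

orderIsomorphic⇒P4231 : ∀ {σ} → OrderIsomorphic σ (4 ∷ 2 ∷ 3 ∷ 1 ∷ []) → P4231 σ
orderIsomorphic⇒P4231 {_ ∷ _ ∷ _ ∷ _ ∷ []} (refl , iso) =
  mk (Equivalence.from (iso 3F 1F) lt)
     (Equivalence.from (iso 1F 2F) lt)
     (Equivalence.from (iso 2F 0F) lt)

avoids⇒Avoid : ∀ {P : Word → Set} {τ w} → (∀ {σ} → P σ → OrderIsomorphic σ τ) → w Avoids τ → Avoid P w
avoids⇒Avoid P⇒ av σ⊆w pσ = av (_ , σ⊆w , P⇒ pσ)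

Avoid⇒avoids : ∀ {P : Word → Set} {τ w} → (∀ {σ} → OrderIsomorphic σ τ → P σ) → Avoid P w → w Avoids τ
Avoid⇒avoids ⇒P av (_ , σ⊆w , iso) = av σ⊆w (⇒P iso)

avoids⇒AvoidT : ∀ {w} → All (w Avoids_) T → AvoidT w
avoids⇒AvoidT (a ∷ b ∷ c ∷ []) =
  avoids⇒Avoid {P = P2143} P2143⇒orderIsomorphic a ,
  avoids⇒Avoid {P = P2341} P2341⇒orderIsomorphic b ,
  avoids⇒Avoid {P = P4231} P4231⇒orderIsomorphic c

AvoidT⇒avoids : ∀ {w} → AvoidT w → All (w Avoids_) T
AvoidT⇒avoids (a , b , c) =
  Avoid⇒avoids orderIsomorphic⇒P2143 a ∷
  Avoid⇒avoids orderIsomorphic⇒P2341 b ∷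
  Avoid⇒avoids orderIsomorphic⇒P4231 c ∷ []

words-unique : ∀ k {as} → Unique as → Unique (words k as)
words-unique zero    _   = [] ∷ []
words-unique (suc k) as! = Unique.cartesianProductWith⁺ _∷_ ∷-injective as! (words-unique k as!)

∈-words⁻ : ∀ k {as w} → w ∈ words k as → length w ≡ k × All (_∈ as) w
∈-words⁻ zero    (here refl) = refl , []
∈-words⁻ (suc k) {as} w∈
  with _ , _ , a∈ , w′∈ , refl ← ∈-cartesianProductWith⁻ _∷_ as (words k as) w∈ =
  let eq , all = ∈-words⁻ k w′∈ in cong suc eq , a∈ ∷ all

∈-words⁺ : ∀ {as w} → All (_∈ as) w → w ∈ words (length w) as
∈-words⁺ []         = here refl
∈-words⁺ (a∈ ∷ all) = ∈-cartesianProductWith⁺ _∷_ a∈ (∈-words⁺ all)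

Unique-resp-↭ : ∀ {v w : Word} → v ↭ w → Unique v → Unique w
Unique-resp-↭ p = SetoidPermutation.Unique-resp-↭ (setoid ℕ) (↭⇒↭ₛ p)

[1‥]-unique : ∀ n → Unique [1‥ n ]
[1‥]-unique n = AllPairs.applyUpTo⁺₁ suc n λ i<j _ → ℕ.<⇒≢ i<j ∘ ℕ.suc-injective

unique-↭ : ∀ {v w : Word} → Unique v → (∀ {a} → a ∈ v → a ∈ w) → length v ≡ length w → v ↭ w
unique-↭ {v} v! v⊆w eq with unique-⊆⇒↭ v! v⊆w
... | []    , p = subst (_↭ _) (++-identityʳ v) p
... | _ ∷ _ , p = contradiction (trans (sym (length-++ v)) (trans (↭-length p) (sym eq))) (ℕ.m+1+n≢m _)

∈-permutations : ∀ n {w} → w ∈ permutations n ⇔ (w ↭ [1‥ n ])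
∈-permutations n = mk⇔
  (λ w∈ → let w∈words , w! = ∈-filter⁻ _ {xs = words n [1‥ n ]} w∈
              eq , all = ∈-words⁻ n w∈words in
          unique-↭ w! (All.lookup all) (trans eq (sym (length-applyUpTo suc n))))
  (λ p → ∈-filter⁺ _
    (subst (λ k → _ ∈ words k [1‥ n ]) (trans (↭-length p) (length-applyUpTo suc n))
      (∈-words⁺ (All.tabulate (∈-resp-↭ p))))
    (Unique-resp-↭ (↭-sym p) ([1‥]-unique n)))

[n‥1] : ℕ → Word
[n‥1] = applyDownFrom suc

[n‥1]↭[1‥n] : ∀ n → [n‥1] n ↭ [1‥ n ]
[n‥1]↭[1‥n] n = subst (_↭ [1‥ n ]) (reverse-applyUpTo suc n) (↭-reverse [1‥ n ])

[n‥1]-decreasing : ∀ n → Decreasing ([n‥1] n)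
[n‥1]-decreasing n = AllPairs.applyDownFrom⁺₁ suc n λ j<i _ → s≤s j<i

count-S : ∀ n → Count (IsT ([n‥1] n)) (length (S n T))
count-S n = record
  { elements = S n T
  ; unique   = Unique.filter⁺ _ (Unique.filter⁺ _ (words-unique n ([1‥]-unique n)))
  ; sound    = λ w∈ → let w∈perms , av = ∈-filter⁻ _ {xs = permutations n} w∈ in
               ↭-trans (Equivalence.to (∈-permutations n) w∈perms) (↭-sym ([n‥1]↭[1‥n] n)) ,
               avoids⇒AvoidT av
  ; complete = λ (p , av) → ∈-filter⁺ _
               (Equivalence.from (∈-permutations n) (↭-trans p ([n‥1]↭[1‥n] n)))
               (AvoidT⇒avoids av)
  ; size     = refl
  }

length-S : ∀ n → length (S n T) ≡ numT n
length-S n = trans (count-functional (count-S n) (count-T ([n‥1] n) ([n‥1]-decreasing n)))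
  (cong numT (length-applyDownFrom suc n))

-- The generating function

open PowerSeries
open ≡-Reasoning

-- One division step strips `h 0` from `h * g` and leaves `(h ∘ suc) * g`, because the Cauchy
-- product unfolds definitionally along its first factor.
longDivision-unique : ∀ {f g} h → f ≈ h * g → g 0 ≡ 1ℤ → longDivision f g ≈ h
longDivision-unique {f} {g} h f≈hg g₀ zero = begin
  f 0                     ≡⟨ f≈hg 0 ⟩
  h 0 ℤ.* g 0 ℤ.+ 0ℤ      ≡⟨ ℤ.+-identityʳ _ ⟩
  h 0 ℤ.* g 0             ≡⟨ cong (h 0 ℤ.*_) g₀ ⟩
  h 0 ℤ.* 1ℤ              ≡⟨ ℤ.*-identityʳ _ ⟩
  h 0                     ∎
longDivision-unique {f} {g} h f≈hg g₀ (suc n) = longDivision-unique (h ∘ suc) shifted g₀ n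
  where
  shifted : (λ k → f (suc k) ℤ.- f 0 ℤ.* g (suc k)) ≈ (h ∘ suc) * g
  shifted k = begin
    f (suc k) ℤ.- f 0 ℤ.* g (suc k)
      ≡⟨ cong₂ (λ l m → l ℤ.- m ℤ.* g (suc k)) (f≈hg (suc k)) (longDivision-unique {g = g} h f≈hg g₀ 0) ⟩
    a ℤ.+ ((h ∘ suc) * g) k ℤ.- a
      ≡⟨ cancel a _ ⟩
    ((h ∘ suc) * g) k ∎
    where
    a = h 0 ℤ.* g (suc k)
    cancel : ∀ i j → i ℤ.+ j ℤ.- i ≡ j
    cancel = ℤ.solve-∀

-- Degree bounds for polynomials

Degree≤ : ℕ → Series → Set
Degree≤ d f = ∀ n → d < n → f n ≡ 0ℤ

+-zero : ∀ {i j} → i ≡ 0ℤ → j ≡ 0ℤ → i ℤ.+ j ≡ 0ℤ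
+-zero refl refl = refl

*-zeroʳ : ∀ i {j} → j ≡ 0ℤ → i ℤ.* j ≡ 0ℤ
*-zeroʳ i refl = ℤ.*-zeroʳ i

degree-weaken : ∀ {d e f} → d ≤ e → Degree≤ d f → Degree≤ e f
degree-weaken d≤e deg n e<n = deg n (ℕ.≤-<-trans d≤e e<n)

degree-1# : Degree≤ 0 1#
degree-1# (suc _) _ = refl

degree-x : Degree≤ 1 x
degree-x (suc (suc _)) _ = refl
degree-x (suc zero) (s≤s ())

degree-+ : ∀ {d f g} → Degree≤ d f → Degree≤ d g → Degree≤ d (f + g)
degree-+ df dg n d<n = +-zero (df n d<n) (dg n d<n)

degree-- : ∀ {d f g} → Degree≤ d f → Degree≤ d g → Degree≤ d (f - g)
degree-- df dg n d<n = +-zero (df n d<n) (cong ℤ.-_ (dg n d<n))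

degree-· : ∀ {d f} k → Degree≤ d f → Degree≤ d (k · f)
degree-· zero    df zero    _ = refl
degree-· zero    df (suc _) _ = refl
degree-· (suc k) df n d<n = +-zero (df n d<n) (degree-· k df n d<n)

zero-* : ∀ {f} g → (∀ n → f n ≡ 0ℤ) → ∀ n → (f * g) n ≡ 0ℤ
zero-* g f≡0 zero    rewrite f≡0 0 = refl
zero-* g f≡0 (suc n) rewrite f≡0 0 = trans (ℤ.+-identityˡ _) (zero-* g (f≡0 ∘ suc) n)

degree-* : ∀ {d e f g} → Degree≤ d f → Degree≤ e g → Degree≤ (d ℕ.+ e) (f * g)
degree-* {zero}  {f = f} {g} df dg (suc n) e<n = +-zero
  (*-zeroʳ (f 0) (dg _ e<n))
  (zero-* g (λ m → df (suc m) (s≤s z≤n)) n)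
degree-* {suc d} {e} {f} {g} df dg (suc n) d+e<n = +-zero
  (*-zeroʳ (f 0) (dg _ (ℕ.≤-<-trans (ℕ.m≤n+m e (suc d)) d+e<n)))
  (degree-* {d} {e} {f ∘ suc} {g} (λ m d<m → df (suc m) (s≤s d<m)) dg n (s≤s⁻¹ d+e<n))

degree-^ : ∀ {d f} k → Degree≤ d f → Degree≤ (k ℕ.* d) (f ^ k)
degree-^ zero    df = degree-1#
degree-^ {d} {f} (suc k) df = degree-* {d} {k ℕ.* d} {f} {f ^ k} df (degree-^ k df)

-- Coefficient `n + d` involves only the window of `h` from `n` to `n + d`. Shifting `h` brings the
-- index down to the fixed number `d`, at which the product can be evaluated.
*-high : ∀ {d g} h → Degree≤ d g → ∀ n → (h * g) (n ℕ.+ d) ≡ ((λ i → h (n ℕ.+ i)) * g) d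
*-high         h dg zero    = refl
*-high {d} {g} h dg (suc n) = begin
  h 0 ℤ.* g (suc n ℕ.+ d) ℤ.+ ((h ∘ suc) * g) (n ℕ.+ d)
    ≡⟨ cong (ℤ._+ ((h ∘ suc) * g) (n ℕ.+ d)) (*-zeroʳ (h 0) (dg _ (s≤s (ℕ.m≤n+m d n)))) ⟩
  0ℤ ℤ.+ ((h ∘ suc) * g) (n ℕ.+ d)
    ≡⟨ ℤ.+-identityˡ _ ⟩
  ((h ∘ suc) * g) (n ℕ.+ d)
    ≡⟨ *-high (h ∘ suc) dg n ⟩
  ((λ i → h (suc n ℕ.+ i)) * g) d ∎

numerator denominator : Series
numerator   = 1# - 6 · x + 13 · x ^ 2 - 11 · x ^ 3 + 5 · x ^ 4
denominator = (1# - x) ^ 2 * (1# - 2 · x) * (1# - 3 · x + x ^ 2)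

degree-numerator : Degree≤ 4 numerator
degree-numerator =
  degree-+ {f = 1# - 6 · x + 13 · x ^ 2 - 11 · x ^ 3}
    (degree-- {f = 1# - 6 · x + 13 · x ^ 2}
      (degree-+ {f = 1# - 6 · x}
        (degree-- {f = 1#} (degree-weaken z≤n degree-1#) (degree-· 6 (degree-weaken (s≤s z≤n) degree-x)))
        (degree-· 13 (degree-x^ 2 (ℕ.m≤m+n 2 2))))
      (degree-· 11 (degree-x^ 3 (ℕ.m≤m+n 3 1))))
    (degree-· 5 (degree-x^ 4 ℕ.≤-refl))
  where
  degree-x^ : ∀ k → k ≤ 4 → Degree≤ 4 (x ^ k)
  degree-x^ k k≤4 = degree-weaken (ℕ.≤-trans (ℕ.≤-reflexive (ℕ.*-identityʳ k)) k≤4)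
    (degree-^ {f = x} k degree-x)

degree-denominator : Degree≤ 5 denominator
degree-denominator =
  degree-* {3} {2} {(1# - x) ^ 2 * (1# - 2 · x)} {1# - 3 · x + x ^ 2}
    (degree-* {2} {1} {(1# - x) ^ 2} {1# - 2 · x}
      (degree-^ {f = 1# - x} 2 (degree-- {f = 1#} (degree-weaken z≤n degree-1#) degree-x))
      (linear 2))
    (degree-+ {f = 1# - 3 · x} (degree-weaken (s≤s z≤n) (linear 3)) (degree-^ {f = x} 2 degree-x))
  where
  linear : ∀ k → Degree≤ 1 (1# - k · x)
  linear k = degree-- {f = 1#} (degree-weaken z≤n degree-1#) (degree-· k degree-x)

numerator≈ : numerator ≈ (λ n → + numT n) * denominator
-- Below the degree 5 of the denominator both sides are closed numbers: the initial values of `numT`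
-- determine the numerator.
numerator≈ 0 = refl
numerator≈ 1 = refl
numerator≈ 2 = refl
numerator≈ 3 = refl
numerator≈ 4 = refl
numerator≈ (suc (suc (suc (suc (suc n))))) = begin
  numerator (5 ℕ.+ n)                         ≡⟨ degree-numerator _ (ℕ.m≤m+n 5 n) ⟩
  0ℤ                                          ≡⟨ numT-recurrence n ⟨
  ((λ i → + numT (n ℕ.+ i)) * denominator) 5  ≡⟨ *-high (λ i → + numT i) degree-denominator n ⟨
  ((λ n → + numT n) * denominator) (n ℕ.+ 5)  ≡⟨ cong ((λ n → + numT n) * denominator) (ℕ.+-comm n 5) ⟩
  ((λ n → + numT n) * denominator) (5 ℕ.+ n)  ∎

theorem4 : F T ≈ (1# - 6 · x + 13 · x ^ 2 - 11 · x ^ 3 + 5 · x ^ 4)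
    / ((1# - x) ^ 2 * (1# - 2 · x) * (1# - 3 · x + x ^ 2))
theorem4 n = begin
  F T n                                ≡⟨ cong +_ (length-S n) ⟩
  + numT n                             ≡⟨ longDivision-unique {g = denominator} (λ n → + numT n) numerator≈ refl n ⟨
  longDivision numerator denominator n ∎
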